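{- For all integers $k\ge 1$, $n\ge 0$ and all $$(a,b,c)\in\{(1,2,3),(1,2,5),(1,2,7),(1,3,4),(1,3,5),(1,3,8),(1,4,5),(1,4,7)\},$$ we have $\gamma_{a,b,c,3/2,1/2}^k(n)\ge 0$; that is, the coefficient of $q^n$ in $$\frac{1}{(1-q^a)(1-q^b)(1-q^c)}\sum_{j\notin[-k,k-1]}(-1)^{j+k}q^{j(3j+1)/2}$$ is nonnegative.
   Context: Identities are between formal power series in $q$. The sum $\sum_{j\notin[-k,k-1]}$ is over all integers $j\le -k-1$ and all integers $j\ge k$. In general $\gamma_{a,b,c,A,B}^k(n)$ is defined by $\frac{1}{(1-q^a)(1-q^b)(1-q^c)}\sum_{j\notin[-k,k-1]}(-1)^{j+k}q^{Aj^2+Bj}=\sum_{n\ge0}\gamma_{a,b,c,A,B}^k(n)q^n$. -}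

module Defs where

open import Algebra.Bundles using (CommutativeMonoid)
import Algebra.Properties.CommutativeSemigroup as CommutativeSemigroupProperties
open import Data.Bool.Base using (if_then_else_)
open import Data.Fin.Base using (toℕ)
open import Data.Integer.Base as ℤ using (ℤ; +_; 0ℤ; 1ℤ; -1ℤ; ∣_∣)
import Data.Integer.Properties as ℤ
import Data.Integer.Tactic.RingSolver as ℤ-Solver
open import Data.Nat.Base as ℕ using (ℕ; zero; suc; z≤n; s≤s)
open import Data.Nat.Divisibility using (_∣_; _∣?_; ∣m+n∣m⇒∣n; ∣m∣n⇒∣m+n; ∣-refl; _∣0; >⇒∤)
import Data.Nat.Properties as ℕ
import Data.Nat.Tactic.RingSolver as ℕ-Solver
open import Data.Product.Base using (_,_)
open import Data.Rational.Base as ℚ using (ℚ; mkℚ; _/_; ↥_; ↧ₙ_; toℚᵘ)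
import Data.Rational.Properties as ℚ
open import Data.Rational.Unnormalised.Base as ℚᵘ using (mkℚᵘ; *≡*)
import Data.Rational.Unnormalised.Properties as ℚᵘ
open import Function.Base using (_∘_)
open import Level using (0ℓ)
open import Relation.Binary.PropositionalEquality
  using (_≡_; _≢_; _≗_; refl; sym; trans; cong; cong₂; subst; module ≡-Reasoning)
open import Relation.Nullary using (Dec; does; yes; no; ¬_)
open import Relation.Nullary.Decidable using (dec-true; dec-false)

open import Algebra.Properties.Semiring.Sum ℤ.+-*-semiring
  using (sum⁺-syntax; sum-syntax; sum-cong-≗; ∑-distrib-+; *-distribˡ-sum)

------------------------------------------------------------------------
-- Formal power series in q over ℤ: f n is the coefficient of qⁿ

Series : Set
Series = ℕ → ℤ

infixl 6 _⊕_ _⊖_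
infixl 7 _⊛_
infixr 8 q^_

_⊕_ : Series → Series → Series
(f ⊕ g) n = f n ℤ.+ g n

_⊖_ : Series → Series → Series
(f ⊖ g) n = f n ℤ.- g n

_⊛_ : Series → Series → Series
(f ⊛ g) n = ∑[ i ≤ n ] (f (toℕ i) ℤ.* g (n ℕ.∸ toℕ i))

-- The exponent is rational because A j² + B j is; q^ e is the monomial
-- only if e is a natural number, and the zero series otherwise.
q^_ : ℚ → Series
(q^ e) n = if does (e ℚ.≟ + n / 1) then 1ℤ else 0ℤ

𝟙 : Series
𝟙 = q^ ℚ.0ℚ

1-q^ : ℕ → Series
1-q^ a = 𝟙 ⊖ q^ (+ a / 1)

-- 1 / (1 − q^a) = Σ_{i ≥ 0} q^{a i} for a ≥ 1; see 1-q^-inverse.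
1/1-q^ : ℕ → Series
1/1-q^ a n = if does (a ∣? n) then 1ℤ else 0ℤ

------------------------------------------------------------------------
-- The truncated theta series Σ_{j ∉ [-k, k-1]} (-1)^{j+k} q^{A j² + B j}

exponent : ℚ → ℚ → ℤ → ℚ
exponent A B j = A ℚ.* (j / 1) ℚ.* (j / 1) ℚ.+ B ℚ.* (j / 1)

term : ℚ → ℚ → ℕ → ℤ → Series
term A B k j n = (-1ℤ ℤ.^ ∣ j ℤ.+ + k ∣) ℤ.* (q^ (exponent A B j)) n

-- The integers outside [-k, k-1] are the k + i and the -k-1-i with i ≥ 0.
-- This is the sum over those with i ≤ N.
partialθ : ℚ → ℚ → ℕ → ℕ → Series
partialθ A B k N n =
  ∑[ i ≤ N ] (term A B k (+ (k ℕ.+ toℕ i)) n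
              ℤ.+ term A B k (ℤ.- + suc (k ℕ.+ toℕ i)) n)

-- For A > 0, A j² + B j = n forces ∣ j ∣ ≤ bound A B n (exponent⇒≤bound).
bound : ℚ → ℚ → ℕ → ℕ
bound A B n = ↧ₙ A ℕ.* (n ℕ.+ ∣ ↥ B ∣)

-- The infinite sum for A > 0: each coefficient of the partial sums is
-- constant from N = bound A B n on (partialθ-stable).
θ : ℚ → ℚ → ℕ → Series
θ A B k n = partialθ A B k (bound A B n) n

γ : (a b c : ℕ) (A B : ℚ) (k : ℕ) → Series
γ a b c A B k = (1/1-q^ a ⊛ 1/1-q^ b ⊛ 1/1-q^ c) ⊛ θ A B k

------------------------------------------------------------------------
-- Series form a commutative monoid under ⊛

private
  if-yes : ∀ {P : Set} (P? : Dec P) → P → (if does P? then 1ℤ else 0ℤ) ≡ 1ℤ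
  if-yes P? p = cong (if_then 1ℤ else 0ℤ) (dec-true P? p)

  if-no : ∀ {P : Set} (P? : Dec P) → ¬ P → (if does P? then 1ℤ else 0ℤ) ≡ 0ℤ
  if-no P? ¬p = cong (if_then 1ℤ else 0ℤ) (dec-false P? ¬p)

  if-⇔ : ∀ {P Q : Set} (P? : Dec P) (Q? : Dec Q) → (P → Q) → (Q → P) →
         (if does P? then 1ℤ else 0ℤ) ≡ (if does Q? then 1ℤ else 0ℤ)
  if-⇔ P? Q? f g with Q?
  ... | yes q = if-yes P? (g q)
  ... | no ¬q = if-no P? (¬q ∘ f)

  /1-injective : ∀ {i j} → i / 1 ≡ j / 1 → i ≡ j
  /1-injective {i} {j} eq with ℚ./-injective-≃ (mkℚᵘ i 0) (mkℚᵘ j 0) eq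
  ... | *≡* i*1≡j*1 =
    trans (sym (ℤ.*-identityʳ i)) (trans i*1≡j*1 (ℤ.*-identityʳ j))

  /1-injective-ℕ : ∀ m n → + m / 1 ≡ + n / 1 → m ≡ n
  /1-injective-ℕ m n eq = ℤ.+-injective (/1-injective {+ m} {+ n} eq)

  q^-suc : ∀ a n → (q^ (+ suc a / 1)) (suc n) ≡ (q^ (+ a / 1)) n
  q^-suc a n = if-⇔ (+ suc a / 1 ℚ.≟ + suc n / 1) (+ a / 1 ℚ.≟ + n / 1)
    (λ eq → cong (λ x → + x / 1) (ℕ.suc-injective (/1-injective-ℕ (suc a) (suc n) eq)))
    (λ eq → cong (λ x → + suc x / 1) (/1-injective-ℕ a n eq))

  q^-≢ : ∀ {a n} → a ≢ n → (q^ (+ a / 1)) n ≡ 0ℤ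
  q^-≢ {a} {n} a≢n = if-no (+ a / 1 ℚ.≟ + n / 1) (a≢n ∘ /1-injective-ℕ a n)

⊛-cong : ∀ {f f′ g g′} → f ≗ f′ → g ≗ g′ → f ⊛ g ≗ f′ ⊛ g′
⊛-cong f≗f′ g≗g′ n = sum-cong-≗ {suc n} λ i →
  cong₂ ℤ._*_ (f≗f′ (toℕ i)) (g≗g′ (n ℕ.∸ toℕ i))

⊛-distribʳ : ∀ h f g → (f ⊕ g) ⊛ h ≗ f ⊛ h ⊕ g ⊛ h
⊛-distribʳ h f g n = trans
  (sum-cong-≗ {suc n} λ i → ℤ.*-distribʳ-+ (h (n ℕ.∸ toℕ i)) (f (toℕ i)) (g (toℕ i)))
  (∑-distrib-+ {suc n} (λ i → f (toℕ i) ℤ.* h (n ℕ.∸ toℕ i))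
                       (λ i → g (toℕ i) ℤ.* h (n ℕ.∸ toℕ i)))

⊛-scale : ∀ c f g n → ((λ m → c ℤ.* f m) ⊛ g) n ≡ c ℤ.* (f ⊛ g) n
⊛-scale c f g n = trans
  (sum-cong-≗ {suc n} λ i → ℤ.*-assoc c (f (toℕ i)) (g (n ℕ.∸ toℕ i)))
  (sym (*-distribˡ-sum {suc n} c λ i → f (toℕ i) ℤ.* g (n ℕ.∸ toℕ i)))

⊛-unsnoc : ∀ f g n → (f ⊛ g) (suc n) ≡ (f ⊛ (g ∘ suc)) n ℤ.+ f (suc n) ℤ.* g 0
⊛-unsnoc f g zero = lemma (f 0) (g 1) (f 1) (g 0)
  where
  lemma : ∀ a b c d → a ℤ.* b ℤ.+ (c ℤ.* d ℤ.+ 0ℤ) ≡ (a ℤ.* b ℤ.+ 0ℤ) ℤ.+ c ℤ.* d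
  lemma = ℤ-Solver.solve-∀
⊛-unsnoc f g (suc n) = trans
  (cong (λ x → f 0 ℤ.* g (suc (suc n)) ℤ.+ x) (⊛-unsnoc (f ∘ suc) g n))
  (sym (ℤ.+-assoc (f 0 ℤ.* g (suc (suc n))) _ _))

⊛-comm : ∀ f g → f ⊛ g ≗ g ⊛ f
⊛-comm f g zero    = cong (ℤ._+ 0ℤ) (ℤ.*-comm (f 0) (g 0))
⊛-comm f g (suc n) = begin
  f 0 ℤ.* g (suc n) ℤ.+ ((f ∘ suc) ⊛ g) n  ≡⟨ cong₂ ℤ._+_ (ℤ.*-comm (f 0) (g (suc n))) (⊛-comm (f ∘ suc) g n) ⟩
  g (suc n) ℤ.* f 0 ℤ.+ (g ⊛ (f ∘ suc)) n  ≡⟨ ℤ.+-comm (g (suc n) ℤ.* f 0) _ ⟩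
  (g ⊛ (f ∘ suc)) n ℤ.+ g (suc n) ℤ.* f 0  ≡⟨ ⊛-unsnoc g f n ⟨
  (g ⊛ f) (suc n)                          ∎
  where open ≡-Reasoning

⊛-assoc : ∀ f g h → (f ⊛ g) ⊛ h ≗ f ⊛ (g ⊛ h)
⊛-assoc f g h zero = lemma (f 0) (g 0) (h 0)
  where
  lemma : ∀ a b c → (a ℤ.* b ℤ.+ 0ℤ) ℤ.* c ℤ.+ 0ℤ ≡ a ℤ.* (b ℤ.* c ℤ.+ 0ℤ) ℤ.+ 0ℤ
  lemma = ℤ-Solver.solve-∀
⊛-assoc f g h (suc n) = begin
  (f₀ ℤ.* g 0 ℤ.+ 0ℤ) ℤ.* h (suc n) ℤ.+ (((λ m → f₀ ℤ.* g (suc m)) ⊕ (f ∘ suc) ⊛ g) ⊛ h) n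
    ≡⟨ cong (λ x → (f₀ ℤ.* g 0 ℤ.+ 0ℤ) ℤ.* h (suc n) ℤ.+ x) (begin
         (((λ m → f₀ ℤ.* g (suc m)) ⊕ (f ∘ suc) ⊛ g) ⊛ h) n
           ≡⟨ ⊛-distribʳ h (λ m → f₀ ℤ.* g (suc m)) ((f ∘ suc) ⊛ g) n ⟩
         ((λ m → f₀ ℤ.* g (suc m)) ⊛ h) n ℤ.+ ((f ∘ suc) ⊛ g ⊛ h) n
           ≡⟨ cong₂ ℤ._+_ (⊛-scale f₀ (g ∘ suc) h n) (⊛-assoc (f ∘ suc) g h n) ⟩
         f₀ ℤ.* ((g ∘ suc) ⊛ h) n ℤ.+ ((f ∘ suc) ⊛ (g ⊛ h)) n ∎) ⟩
  (f₀ ℤ.* g 0 ℤ.+ 0ℤ) ℤ.* h (suc n) ℤ.+ (f₀ ℤ.* ((g ∘ suc) ⊛ h) n ℤ.+ ((f ∘ suc) ⊛ (g ⊛ h)) n)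
    ≡⟨ lemma f₀ (g 0) (h (suc n)) _ _ ⟩
  f₀ ℤ.* (g 0 ℤ.* h (suc n) ℤ.+ ((g ∘ suc) ⊛ h) n) ℤ.+ ((f ∘ suc) ⊛ (g ⊛ h)) n ∎
  where
  open ≡-Reasoning
  f₀ = f 0
  lemma : ∀ a b c d e → (a ℤ.* b ℤ.+ 0ℤ) ℤ.* c ℤ.+ (a ℤ.* d ℤ.+ e) ≡ a ℤ.* (b ℤ.* c ℤ.+ d) ℤ.+ e
  lemma = ℤ-Solver.solve-∀

private
  ⊛-zeroˡ : ∀ f g → (∀ n → f n ≡ 0ℤ) → ∀ n → (f ⊛ g) n ≡ 0ℤ
  ⊛-zeroˡ f g f≡0 zero = cong (λ x → x ℤ.* g 0 ℤ.+ 0ℤ) (f≡0 0)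
  ⊛-zeroˡ f g f≡0 (suc n) = cong₂ ℤ._+_
    (cong (ℤ._* g (suc n)) (f≡0 0)) (⊛-zeroˡ (f ∘ suc) g (f≡0 ∘ suc) n)

  q^-⊛-+ : ∀ a g n → (q^ (+ a / 1) ⊛ g) (a ℕ.+ n) ≡ g n
  q^-⊛-+ zero g zero = trans (ℤ.+-identityʳ _) (ℤ.*-identityˡ (g 0))
  q^-⊛-+ zero g (suc n) = trans
    (cong₂ ℤ._+_ (ℤ.*-identityˡ (g (suc n)))
      (⊛-zeroˡ (𝟙 ∘ suc) g (λ m → q^-≢ {0} {suc m} λ ()) n))
    (ℤ.+-identityʳ _)
  q^-⊛-+ (suc a) g n = begin
    (q^ (+ suc a / 1)) 0 ℤ.* g (suc (a ℕ.+ n)) ℤ.+ (((q^ (+ suc a / 1)) ∘ suc) ⊛ g) (a ℕ.+ n)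
      ≡⟨ cong₂ ℤ._+_ (cong (ℤ._* g (suc (a ℕ.+ n))) (q^-≢ {suc a} {0} λ ()))
                     (⊛-cong {g = g} (q^-suc a) (λ _ → refl) (a ℕ.+ n)) ⟩
    0ℤ ℤ.+ (q^ (+ a / 1) ⊛ g) (a ℕ.+ n)
      ≡⟨ trans (ℤ.+-identityˡ _) (q^-⊛-+ a g n) ⟩
    g n ∎
    where open ≡-Reasoning

  q^-⊛-< : ∀ {a n} g → n ℕ.< a → (q^ (+ a / 1) ⊛ g) n ≡ 0ℤ
  q^-⊛-< {suc a} {zero} g _ = cong (λ x → x ℤ.* g 0 ℤ.+ 0ℤ) (q^-≢ {suc a} {0} λ ())
  q^-⊛-< {suc a} {suc n} g (s≤s n<a) = cong₂ ℤ._+_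
    (cong (ℤ._* g (suc n)) (q^-≢ {suc a} {0} λ ()))
    (trans (⊛-cong {g = g} (q^-suc a) (λ _ → refl) n) (q^-⊛-< g n<a))

⊛-identityˡ : ∀ f → 𝟙 ⊛ f ≗ f
⊛-identityˡ = q^-⊛-+ 0

⊛-commutativeMonoid : CommutativeMonoid 0ℓ 0ℓ
⊛-commutativeMonoid = record
  { Carrier = Series ; _≈_ = _≗_ ; _∙_ = _⊛_ ; ε = 𝟙
  ; isCommutativeMonoid = record
    { isMonoid = record
      { isSemigroup = record
        { isMagma = record
          { isEquivalence = record
            { refl = λ _ → refl ; sym = λ p n → sym (p n) ; trans = λ p q n → trans (p n) (q n) }
          ; ∙-cong = ⊛-cong
          }
        ; assoc = ⊛-assoc
        }
      ; identity = ⊛-identityˡ , λ f n → trans (⊛-comm f 𝟙 n) (⊛-identityˡ f n)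
      }
    ; comm = ⊛-comm
    }
  }

------------------------------------------------------------------------
-- The series 1/1-q^ a and γ satisfy the equations defining them

1-q^-inverse : ∀ a .{{_ : ℕ.NonZero a}} → 1-q^ a ⊛ 1/1-q^ a ≗ 𝟙
1-q^-inverse a n = begin
  (1-q^ a ⊛ geo) n
    ≡⟨ ⊛-cong {g = geo} (λ m → cong (λ x → 𝟙 m ℤ.+ x) (sym (ℤ.-1*i≡-i ((q^ (+ a / 1)) m)))) (λ _ → refl) n ⟩
  ((𝟙 ⊕ λ m → -1ℤ ℤ.* (q^ (+ a / 1)) m) ⊛ geo) n
    ≡⟨ ⊛-distribʳ geo 𝟙 (λ m → -1ℤ ℤ.* (q^ (+ a / 1)) m) n ⟩
  (𝟙 ⊛ geo) n ℤ.+ ((λ m → -1ℤ ℤ.* (q^ (+ a / 1)) m) ⊛ geo) n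
    ≡⟨ cong₂ ℤ._+_ (⊛-identityˡ geo n) (trans (⊛-scale -1ℤ (q^ (+ a / 1)) geo n) (ℤ.-1*i≡-i _)) ⟩
  geo n ℤ.- (q^ (+ a / 1) ⊛ geo) n
    ≡⟨ difference n ⟩
  𝟙 n ∎
  where
  open ≡-Reasoning
  geo = 1/1-q^ a

  below : ∀ n → n ℕ.< a → geo n ≡ 𝟙 n
  below zero    _   = if-yes (a ∣? 0) (a ∣0)
  below (suc n) n<a = trans
    (if-no (a ∣? suc n) (>⇒∤ n<a))
    (sym (q^-≢ {0} {suc n} λ ()))

  0≢a+n : ∀ n → 0 ≢ a ℕ.+ n
  0≢a+n n eq = ℕ.≢-nonZero⁻¹ a (ℕ.m+n≡0⇒m≡0 a (sym eq))

  above : ∀ n → geo (a ℕ.+ n) ℤ.- (q^ (+ a / 1) ⊛ geo) (a ℕ.+ n) ≡ 𝟙 (a ℕ.+ n)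
  above n = begin
    geo (a ℕ.+ n) ℤ.- (q^ (+ a / 1) ⊛ geo) (a ℕ.+ n)
      ≡⟨ cong₂ ℤ._-_ (if-⇔ (a ∣? (a ℕ.+ n)) (a ∣? n) (λ p → ∣m+n∣m⇒∣n p ∣-refl) (∣m∣n⇒∣m+n ∣-refl))
                     (q^-⊛-+ a geo n) ⟩
    geo n ℤ.- geo n  ≡⟨ ℤ.+-inverseʳ (geo n) ⟩
    0ℤ               ≡⟨ q^-≢ {0} {a ℕ.+ n} (0≢a+n n) ⟨
    𝟙 (a ℕ.+ n)      ∎

  difference : ∀ n → geo n ℤ.- (q^ (+ a / 1) ⊛ geo) n ≡ 𝟙 n
  difference n with n ℕ.<? a
  ... | yes n<a = trans (cong₂ ℤ._-_ (below n n<a) (q^-⊛-< geo n<a)) (ℤ.+-identityʳ (𝟙 n))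
  ... | no  n≮a = subst (λ m → geo m ℤ.- (q^ (+ a / 1) ⊛ geo) m ≡ 𝟙 m)
                        (ℕ.m+[n∸m]≡n (ℕ.≮⇒≥ n≮a)) (above (n ℕ.∸ a))

γ-equation : ∀ a b c A B k
             .{{_ : ℕ.NonZero a}} .{{_ : ℕ.NonZero b}} .{{_ : ℕ.NonZero c}} →
             (1-q^ a ⊛ 1-q^ b ⊛ 1-q^ c) ⊛ γ a b c A B k ≗ θ A B k
γ-equation a b c A B k = begin
  (1-q^ a ⊛ 1-q^ b ⊛ 1-q^ c) ⊛ ((1/1-q^ a ⊛ 1/1-q^ b ⊛ 1/1-q^ c) ⊛ θ A B k)
    ≈⟨ assoc (1-q^ a ⊛ 1-q^ b ⊛ 1-q^ c) (1/1-q^ a ⊛ 1/1-q^ b ⊛ 1/1-q^ c) (θ A B k) ⟨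
  ((1-q^ a ⊛ 1-q^ b ⊛ 1-q^ c) ⊛ (1/1-q^ a ⊛ 1/1-q^ b ⊛ 1/1-q^ c)) ⊛ θ A B k
    ≈⟨ ∙-cong inverse (λ _ → refl) ⟩
  𝟙 ⊛ θ A B k
    ≈⟨ identityˡ (θ A B k) ⟩
  θ A B k ∎
  where
  open CommutativeMonoid ⊛-commutativeMonoid
    using (setoid; commutativeSemigroup; assoc; ∙-cong; identityˡ)
  open CommutativeSemigroupProperties commutativeSemigroup using (interchange)
  open import Relation.Binary.Reasoning.Setoid setoid

  inverse : (1-q^ a ⊛ 1-q^ b ⊛ 1-q^ c) ⊛ (1/1-q^ a ⊛ 1/1-q^ b ⊛ 1/1-q^ c) ≗ 𝟙
  inverse = begin
    (1-q^ a ⊛ 1-q^ b ⊛ 1-q^ c) ⊛ (1/1-q^ a ⊛ 1/1-q^ b ⊛ 1/1-q^ c)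
      ≈⟨ interchange (1-q^ a ⊛ 1-q^ b) (1-q^ c) (1/1-q^ a ⊛ 1/1-q^ b) (1/1-q^ c) ⟩
    ((1-q^ a ⊛ 1-q^ b) ⊛ (1/1-q^ a ⊛ 1/1-q^ b)) ⊛ (1-q^ c ⊛ 1/1-q^ c)
      ≈⟨ ∙-cong (interchange (1-q^ a) (1-q^ b) (1/1-q^ a) (1/1-q^ b)) (1-q^-inverse c) ⟩
    ((1-q^ a ⊛ 1/1-q^ a) ⊛ (1-q^ b ⊛ 1/1-q^ b)) ⊛ 𝟙
      ≈⟨ ∙-cong (∙-cong (1-q^-inverse a) (1-q^-inverse b)) (λ _ → refl) ⟩
    (𝟙 ⊛ 𝟙) ⊛ 𝟙
      ≈⟨ ∙-cong {𝟙 ⊛ 𝟙} {𝟙} {𝟙} {𝟙} (identityˡ 𝟙) (λ _ → refl) ⟩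
    𝟙 ⊛ 𝟙
      ≈⟨ identityˡ 𝟙 ⟩
    𝟙 ∎

------------------------------------------------------------------------
-- θ is the coefficientwise limit of the partial sums

exponent⇒≤bound : ∀ A B .{{_ : ℚ.Positive A}} j n →
                  exponent A B j ≡ + n / 1 → ∣ j ∣ ℕ.≤ bound A B n
exponent⇒≤bound A@(mkℚ (+ suc p) d-1 _) B@(mkℚ r e-1 _) j n eq
  with ∣ j ∣ in ∣j∣≡x
... | zero  = z≤n
... | suc y = ℕ.*-cancelˡ-≤ x (ℕ.*-cancelˡ-≤ e main)
  where
  open ℕ.≤-Reasoning
  x = suc y
  d = suc d-1
  e = suc e-1

  unnormalised : mkℚᵘ (+ suc p) d-1 ℚᵘ.* mkℚᵘ j 0 ℚᵘ.* mkℚᵘ j 0 ℚᵘ.+ mkℚᵘ r e-1 ℚᵘ.* mkℚᵘ j 0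
                 ℚᵘ.≃ mkℚᵘ (+ n) 0
  unnormalised = ℚᵘ.≃-trans (ℚᵘ.≃-sym lhs)
    (ℚᵘ.≃-trans (ℚ.toℚᵘ-cong eq) (ℚ.toℚᵘ-fromℚᵘ (mkℚᵘ (+ n) 0)))
    where
    j≃ : toℚᵘ (j / 1) ℚᵘ.≃ mkℚᵘ j 0
    j≃ = ℚ.toℚᵘ-fromℚᵘ (mkℚᵘ j 0)
    J = j / 1
    lhs : toℚᵘ (exponent A B j) ℚᵘ.≃
          mkℚᵘ (+ suc p) d-1 ℚᵘ.* mkℚᵘ j 0 ℚᵘ.* mkℚᵘ j 0 ℚᵘ.+ mkℚᵘ r e-1 ℚᵘ.* mkℚᵘ j 0
    lhs = ℚᵘ.≃-trans (ℚ.toℚᵘ-homo-+ (A ℚ.* J ℚ.* J) (B ℚ.* J)) (ℚᵘ.+-cong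
      (ℚᵘ.≃-trans (ℚ.toℚᵘ-homo-* (A ℚ.* J) J)
        (ℚᵘ.*-cong (ℚᵘ.≃-trans (ℚ.toℚᵘ-homo-* A J) (ℚᵘ.*-congˡ {toℚᵘ A} j≃)) j≃))
      (ℚᵘ.≃-trans (ℚ.toℚᵘ-homo-* B J) (ℚᵘ.*-congˡ {toℚᵘ B} j≃)))

  cleared : + e ℤ.* + suc p ℤ.* (j ℤ.* j) ≡ + d ℤ.* + e ℤ.* + n ℤ.- + d ℤ.* r ℤ.* j
  cleared with unnormalised
  ... | *≡* cross rewrite ℕ.*-identityʳ d-1 | ℕ.*-identityʳ d-1 | ℕ.*-identityʳ e-1 =
    isolate (+ suc p) (+ d) r (+ e) j (+ n)
      (trans cross (cong (+ n ℤ.*_) (ℤ.pos-* d e)))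
    where
    lemma : ∀ p d r e j → e ℤ.* p ℤ.* (j ℤ.* j) ≡
            (p ℤ.* j ℤ.* j ℤ.* e ℤ.+ r ℤ.* j ℤ.* d) ℤ.* 1ℤ ℤ.- d ℤ.* r ℤ.* j
    lemma = ℤ-Solver.solve-∀
    lemma′ : ∀ d e n → n ℤ.* (d ℤ.* e) ≡ d ℤ.* e ℤ.* n
    lemma′ = ℤ-Solver.solve-∀
    isolate : ∀ p d r e j n →
              (p ℤ.* j ℤ.* j ℤ.* e ℤ.+ r ℤ.* j ℤ.* d) ℤ.* 1ℤ ≡ n ℤ.* (d ℤ.* e) →
              e ℤ.* p ℤ.* (j ℤ.* j) ≡ d ℤ.* e ℤ.* n ℤ.- d ℤ.* r ℤ.* j
    isolate p d r e j n h = trans (lemma p d r e j)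
      (cong (ℤ._- d ℤ.* r ℤ.* j) (trans h (lemma′ d e n)))

  main : e ℕ.* (x ℕ.* x) ℕ.≤ e ℕ.* (x ℕ.* (d ℕ.* (n ℕ.+ ∣ r ∣)))
  main = begin
    e ℕ.* (x ℕ.* x)
      ≤⟨ ℕ.*-monoˡ-≤ (x ℕ.* x) (ℕ.m≤m*n e (suc p)) ⟩
    e ℕ.* suc p ℕ.* (x ℕ.* x)
      ≡⟨ trans (ℤ.abs-* (+ e ℤ.* + suc p) (j ℤ.* j))
           (cong₂ ℕ._*_ (ℤ.abs-* (+ e) (+ suc p))
             (trans (ℤ.abs-* j j) (cong₂ ℕ._*_ ∣j∣≡x ∣j∣≡x))) ⟨
    ∣ + e ℤ.* + suc p ℤ.* (j ℤ.* j) ∣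
      ≡⟨ cong ∣_∣ cleared ⟩
    ∣ + d ℤ.* + e ℤ.* + n ℤ.- + d ℤ.* r ℤ.* j ∣
      ≤⟨ ℤ.∣i-j∣≤∣i∣+∣j∣ (+ d ℤ.* + e ℤ.* + n) (+ d ℤ.* r ℤ.* j) ⟩
    ∣ + d ℤ.* + e ℤ.* + n ∣ ℕ.+ ∣ + d ℤ.* r ℤ.* j ∣
      ≡⟨ cong₂ ℕ._+_
           (trans (ℤ.abs-* (+ d ℤ.* + e) (+ n)) (cong (ℕ._* n) (ℤ.abs-* (+ d) (+ e))))
           (trans (ℤ.abs-* (+ d ℤ.* r) j) (cong₂ ℕ._*_ (ℤ.abs-* (+ d) r) ∣j∣≡x)) ⟩
    d ℕ.* e ℕ.* n ℕ.+ d ℕ.* ∣ r ∣ ℕ.* x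
      ≤⟨ ℕ.+-mono-≤ (ℕ.m≤m*n (d ℕ.* e ℕ.* n) x) (ℕ.m≤n*m (d ℕ.* ∣ r ∣ ℕ.* x) e) ⟩
    d ℕ.* e ℕ.* n ℕ.* x ℕ.+ e ℕ.* (d ℕ.* ∣ r ∣ ℕ.* x)
      ≡⟨ collect d e n ∣ r ∣ x ⟩
    e ℕ.* (x ℕ.* (d ℕ.* (n ℕ.+ ∣ r ∣))) ∎
    where
    collect : ∀ d e n r x → d ℕ.* e ℕ.* n ℕ.* x ℕ.+ e ℕ.* (d ℕ.* r ℕ.* x) ≡
              e ℕ.* (x ℕ.* (d ℕ.* (n ℕ.+ r)))
    collect = ℕ-Solver.solve-∀

partialθ-stable : ∀ A B .{{_ : ℚ.Positive A}} k n {N} →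
                  bound A B n ℕ.≤ N → partialθ A B k N n ≡ θ A B k n
partialθ-stable A B k n {N} b≤N = stable (s≤s b≤N) summand λ i b<i →
  cong₂ ℤ._+_
    (vanish (+ (k ℕ.+ i)) (ℕ.<-≤-trans b<i (ℕ.m≤n+m i k)))
    (vanish (ℤ.- + suc (k ℕ.+ i)) (ℕ.m<n⇒m<1+n (ℕ.<-≤-trans b<i (ℕ.m≤n+m i k))))
  where
  summand : ℕ → ℤ
  summand i = term A B k (+ (k ℕ.+ i)) n ℤ.+ term A B k (ℤ.- + suc (k ℕ.+ i)) n

  vanish : ∀ j → bound A B n ℕ.< ∣ j ∣ → term A B k j n ≡ 0ℤ
  vanish j b<∣j∣ = trans
    (cong (λ x → (-1ℤ ℤ.^ ∣ j ℤ.+ + k ∣) ℤ.* x)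
      (if-no (exponent A B j ℚ.≟ + n / 1) (ℕ.<⇒≱ b<∣j∣ ∘ exponent⇒≤bound A B j n)))
    (ℤ.*-zeroʳ (-1ℤ ℤ.^ ∣ j ℤ.+ + k ∣))

  zeros : ∀ M (f : ℕ → ℤ) → (∀ i → f i ≡ 0ℤ) → ∑[ i < M ] f (toℕ i) ≡ 0ℤ
  zeros zero    f f≡0 = refl
  zeros (suc M) f f≡0 = cong₂ ℤ._+_ (f≡0 0) (zeros M (f ∘ suc) (f≡0 ∘ suc))

  stable : ∀ {M N} → M ℕ.≤ N → (f : ℕ → ℤ) → (∀ i → M ℕ.≤ i → f i ≡ 0ℤ) →
           ∑[ i < N ] f (toℕ i) ≡ ∑[ i < M ] f (toℕ i)
  stable {N = N} z≤n f f≡0 = zeros N f λ i → f≡0 i z≤n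
  stable (s≤s M≤N) f f≡0 = cong (λ x → f 0 ℤ.+ x)
    (stable M≤N (f ∘ suc) λ i M≤i → f≡0 (suc i) (s≤s M≤i))

{-# OPTIONS --safe #-}
module Submission where

-- Write s = 1 + b + c.  Since 1, b and c are pairwise coprime, the coefficient of qˣ in
-- G = 1/((1-q)(1-q^b)(1-q^c)) satisfies 2bc G x = x (x + s) + ψ x with ψ periodic modulo bc.
-- Pairing j = m with j = -(m+1), γ is an alternating sum over m = k, k+1, … of the blocks
-- G (n - m(3m+1)/2) - G (n - m(3m+1)/2 - (2m+1)).  With x = n - m(3m+1)/2, the quadratic
-- part of 2bc times a block is C m + C (m+1), where C m = m (2x + m + s + 2), so the sum
-- telescopes to C k, up to the last block and the bounded contributions of ψ.  With k + d the
-- last index of a block that is not zero, C k exceeds the errors unless k and d are small; the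
-- finitely many remaining coefficients are computed.

open import Data.Bool.Base using (if_then_else_)
open import Data.Fin.Base using (toℕ)
open import Data.Integer.Base as ℤ using (ℤ; +_; -[1+_]; 0ℤ; 1ℤ; -1ℤ; ∣_∣; _≤_; +≤+)
import Data.Integer.Properties as ℤ
import Data.Integer.Tactic.RingSolver as ℤ-Solver
open import Data.List.Base using (List; _∷_; [])
open import Data.List.Membership.Propositional using (_∈_)
open import Data.List.Relation.Unary.Any using (here; there)
open import Data.Nat.Base using (ℕ)
import Data.Nat.Base as ℕ
open import Data.Nat.Base using (zero; suc; _+_; _*_; _∸_; _<ᵇ_; z≤n; s≤s)
open import Data.Nat.Divisibility using (_∣?_; m∣m*n; ∣-refl; 1∣_)
open import Data.Nat.DivMod
  using (m%n<n; m≡m%n+[m/n]*n; %-distribˡ-+; m∣n⇒o%n%m≡o%m; +-distrib-/-∣ˡ; n/n≡1; m<n⇒m/n≡0; m%n%n≡m%n)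
import Data.Nat.Properties as ℕ
import Data.Nat.Tactic.RingSolver as ℕ-Solver
open import Data.Product.Base using (∃-syntax; _×_; _,_)
open import Data.Rational.Base using (_/_)
import Data.Rational.Base as ℚ
import Data.Rational.Properties as ℚ
open import Data.Rational.Unnormalised.Base as ℚᵘ using (mkℚᵘ; *≡*)
import Data.Rational.Unnormalised.Properties as ℚᵘ
open import Data.Sum.Base using (inj₁; inj₂)
open import Function.Base using (_∘_)
open import Function.Bundles using (mk⇔)
open import Relation.Binary.PropositionalEquality
  using (_≡_; _≗_; refl; sym; trans; cong; cong₂; subst; subst₂; module ≡-Reasoning)
open import Relation.Nullary using (Dec; does; yes; no; contradiction)
open import Relation.Nullary.Decidable using (dec-true; dec-false; does-⇔; from-yes; map′; _×-dec_)
open import Algebra.Properties.Semiring.Sum ℤ.+-*-semiring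
  using (sum⁺-syntax; sum-cong-≗; *-distribˡ-sum)
open import Defs

-- Multiplication by a monomial as a shift of coefficients.

shift : ℕ → Series → Series
shift e f n = if n <ᵇ e then 0ℤ else f (n ∸ e)

shift-≥ : ∀ e f n → shift e f (e + n) ≡ f n
shift-≥ zero    f n = refl
shift-≥ (suc e) f n = shift-≥ e f n

shift-< : ∀ {e n} f → n ℕ.< e → shift e f n ≡ 0ℤ
shift-< {suc e} {zero}  f _         = refl
shift-< {suc e} {suc n} f (s≤s n<e) = shift-< f n<e

shift-cong : ∀ e {f g} → f ≗ g → shift e f ≗ shift e g
shift-cong zero    f≗g n       = f≗g n
shift-cong (suc e) f≗g zero    = refl
shift-cong (suc e) f≗g (suc n) = shift-cong e f≗g n

shift-+ : ∀ d e f → shift (d + e) f ≗ shift d (shift e f)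
shift-+ zero    e f n       = refl
shift-+ (suc d) e f zero    = refl
shift-+ (suc d) e f (suc n) = shift-+ d e f n

shift-⊖ : ∀ e f g → shift e (f ⊖ g) ≗ shift e f ⊖ shift e g
shift-⊖ zero    f g n       = refl
shift-⊖ (suc e) f g zero    = refl
shift-⊖ (suc e) f g (suc n) = shift-⊖ e f g n

shift-* : ∀ e c f n → shift e (λ m → c ℤ.* f m) n ≡ c ℤ.* shift e f n
shift-* zero    c f n       = refl
shift-* (suc e) c f zero    = sym (ℤ.*-zeroʳ c)
shift-* (suc e) c f (suc n) = shift-* e c f n

shift-⊛ : ∀ e f g → shift e f ⊛ g ≗ shift e (f ⊛ g)
shift-⊛ zero    f g n       = refl
shift-⊛ (suc e) f g zero    = refl
shift-⊛ (suc e) f g (suc n) = trans (ℤ.+-identityˡ _) (shift-⊛ e f g n)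

⊛-distribʳ-⊖ : ∀ h f g → (f ⊖ g) ⊛ h ≗ f ⊛ h ⊖ g ⊛ h
⊛-distribʳ-⊖ h f g n = begin
  ((f ⊖ g) ⊛ h) n
    ≡⟨ ⊛-cong {g = h} (λ m → cong (λ x → f m ℤ.+ x) (sym (ℤ.-1*i≡-i (g m)))) (λ _ → refl) n ⟩
  ((f ⊕ λ m → -1ℤ ℤ.* g m) ⊛ h) n
    ≡⟨ ⊛-distribʳ h f (λ m → -1ℤ ℤ.* g m) n ⟩
  (f ⊛ h) n ℤ.+ ((λ m → -1ℤ ℤ.* g m) ⊛ h) n
    ≡⟨ cong (λ x → (f ⊛ h) n ℤ.+ x) (trans (⊛-scale -1ℤ g h n) (ℤ.-1*i≡-i _)) ⟩
  (f ⊛ h) n ℤ.- (g ⊛ h) n ∎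
  where open ≡-Reasoning

-- Monomials and geometric series in terms of shifts.

indicator : ∀ {P : Set} → Dec P → ℤ
indicator P? = if does P? then 1ℤ else 0ℤ

indicator-⇔ : ∀ {P Q : Set} (P? : Dec P) (Q? : Dec Q) → (P → Q) → (Q → P) → indicator P? ≡ indicator Q?
indicator-⇔ P? Q? f g = cong (if_then 1ℤ else 0ℤ) (does-⇔ (mk⇔ f g) P? Q?)

/1-injective : ∀ m n → + m / 1 ≡ + n / 1 → m ≡ n
/1-injective m n eq with ℚ./-injective-≃ (mkℚᵘ (+ m) 0) (mkℚᵘ (+ n) 0) eq
... | *≡* m*1≡n*1 = ℤ.+-injective (ℤ.*-cancelʳ-≡ (+ m) (+ n) 1ℤ m*1≡n*1)

q^-shift : ∀ e → q^ (+ e / 1) ≗ shift e 𝟙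
q^-shift zero    n       = refl
q^-shift (suc e) zero    = cong (if_then 1ℤ else 0ℤ)
  (dec-false (+ suc e / 1 ℚ.≟ + 0 / 1) (ℕ.1+n≢0 ∘ /1-injective (suc e) 0))
q^-shift (suc e) (suc n) = trans
  (indicator-⇔ (+ suc e / 1 ℚ.≟ + suc n / 1) (+ e / 1 ℚ.≟ + n / 1)
    (λ eq → cong (λ x → + x / 1) (ℕ.suc-injective (/1-injective (suc e) (suc n) eq)))
    (λ eq → cong (λ x → + suc x / 1) (/1-injective e n eq)))
  (q^-shift e n)

q^-⊛ : ∀ e f → q^ (+ e / 1) ⊛ f ≗ shift e f
q^-⊛ e f n = begin
  (q^ (+ e / 1) ⊛ f) n ≡⟨ ⊛-cong {g = f} (q^-shift e) (λ _ → refl) n ⟩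
  (shift e 𝟙 ⊛ f) n    ≡⟨ shift-⊛ e 𝟙 f n ⟩
  shift e (𝟙 ⊛ f) n    ≡⟨ shift-cong e (⊛-identityˡ f) n ⟩
  shift e f n          ∎
  where open ≡-Reasoning

-- Multiplying the left side `F` by `1 - q^a` cancels the geometric factor and leaves `f`, so
-- `F = f + q^a F`. This recursion later determines coefficients through `shift-fixpoint-unique`.
1/1-q^-⊛ : ∀ a .{{_ : ℕ.NonZero a}} f → 1/1-q^ a ⊛ f ≗ f ⊕ shift a (1/1-q^ a ⊛ f)
1/1-q^-⊛ a f n = begin
  F n                                  ≡⟨ lemma (F n) (shift a F n) ⟩
  (F n ℤ.- shift a F n) ℤ.+ shift a F n ≡⟨ cong (ℤ._+ shift a F n) difference ⟩
  f n ℤ.+ shift a F n                  ∎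
  where
  open ≡-Reasoning
  F = 1/1-q^ a ⊛ f
  lemma : ∀ i j → i ≡ (i ℤ.- j) ℤ.+ j
  lemma = ℤ-Solver.solve-∀
  difference : F n ℤ.- shift a F n ≡ f n
  difference = begin
    F n ℤ.- shift a F n                  ≡⟨ cong₂ ℤ._-_ (⊛-identityˡ F n) (q^-⊛ a F n) ⟨
    (𝟙 ⊛ F) n ℤ.- (q^ (+ a / 1) ⊛ F) n  ≡⟨ ⊛-distribʳ-⊖ F 𝟙 (q^ (+ a / 1)) n ⟨
    (1-q^ a ⊛ F) n                       ≡⟨ ⊛-assoc (1-q^ a) (1/1-q^ a) f n ⟨
    ((1-q^ a ⊛ 1/1-q^ a) ⊛ f) n          ≡⟨ ⊛-cong {g = f} (1-q^-inverse a) (λ _ → refl) n ⟩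
    (𝟙 ⊛ f) n                            ≡⟨ ⊛-identityˡ f n ⟩
    f n                                  ∎

-- Exponents and signs of the theta terms.

-- The generalized pentagonal numbers j (3 j + 1) / 2 for j = m and, in terms
-- of it, 2 m + 1 + pentagonal m for j = - (m + 1).
pentagonal : ℕ → ℕ
pentagonal zero    = 0
pentagonal (suc m) = 3 * m + 2 + pentagonal m

2*pentagonal : ∀ m → 2 * pentagonal m ≡ m * (3 * m + 1)
2*pentagonal zero    = refl
2*pentagonal (suc m) = begin
  2 * (3 * m + 2 + pentagonal m)     ≡⟨ ℕ.*-distribˡ-+ 2 (3 * m + 2) (pentagonal m) ⟩
  2 * (3 * m + 2) + 2 * pentagonal m ≡⟨ cong (λ x → 2 * (3 * m + 2) + x) (2*pentagonal m) ⟩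
  2 * (3 * m + 2) + m * (3 * m + 1)  ≡⟨ lemma m ⟩
  suc m * (3 * suc m + 1)            ∎
  where
  open ≡-Reasoning
  lemma : ∀ m → 2 * (3 * m + 2) + m * (3 * m + 1) ≡ suc m * (3 * suc m + 1)
  lemma = ℕ-Solver.solve-∀

m[3m+1]≡2*pentagonal : ∀ m → + m ℤ.* (+ 3 ℤ.* + m ℤ.+ 1ℤ) ≡ + 2 ℤ.* + pentagonal m
m[3m+1]≡2*pentagonal m = begin
  + m ℤ.* (+ 3 ℤ.* + m ℤ.+ 1ℤ) ≡⟨ cong (λ x → + m ℤ.* (x ℤ.+ 1ℤ)) (ℤ.pos-* 3 m) ⟨
  + m ℤ.* + (3 * m + 1)        ≡⟨ ℤ.pos-* m (3 * m + 1) ⟨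
  + (m * (3 * m + 1))          ≡⟨ cong +_ (2*pentagonal m) ⟨
  + (2 * pentagonal m)         ≡⟨ ℤ.pos-* 2 (pentagonal m) ⟩
  + 2 ℤ.* + pentagonal m       ∎
  where open ≡-Reasoning

exponent-≡ : ∀ j e → j ℤ.* (+ 3 ℤ.* j ℤ.+ 1ℤ) ≡ + 2 ℤ.* + e →
             exponent (+ 3 / 2) (+ 1 / 2) j ≡ + e / 1
exponent-≡ j e eq = ℚ.toℚᵘ-injective (ℚᵘ.≃-trans unnormalise
  -- Cross-multiplication: the unreduced sum of two fractions over 2 has denominator 4.
  (ℚᵘ.≃-trans (*≡* (trans (lemma j) (trans (cong (ℤ._* + 2) eq) (lemma′ (+ e)))))
    (ℚᵘ.≃-sym (ℚ.toℚᵘ-fromℚᵘ (mkℚᵘ (+ e) 0)))))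
  where
  J = j / 1
  A = + 3 / 2
  B = + 1 / 2
  j≃ : ℚ.toℚᵘ J ℚᵘ.≃ mkℚᵘ j 0
  j≃ = ℚ.toℚᵘ-fromℚᵘ (mkℚᵘ j 0)
  unnormalise : ℚ.toℚᵘ (exponent A B j) ℚᵘ.≃
    mkℚᵘ (+ 3) 1 ℚᵘ.* mkℚᵘ j 0 ℚᵘ.* mkℚᵘ j 0 ℚᵘ.+ mkℚᵘ (+ 1) 1 ℚᵘ.* mkℚᵘ j 0
  unnormalise = ℚᵘ.≃-trans (ℚ.toℚᵘ-homo-+ (A ℚ.* J ℚ.* J) (B ℚ.* J)) (ℚᵘ.+-cong
    (ℚᵘ.≃-trans (ℚ.toℚᵘ-homo-* (A ℚ.* J) J)
      (ℚᵘ.*-cong (ℚᵘ.≃-trans (ℚ.toℚᵘ-homo-* A J) (ℚᵘ.*-congˡ {ℚ.toℚᵘ A} j≃)) j≃))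
    (ℚᵘ.≃-trans (ℚ.toℚᵘ-homo-* B J) (ℚᵘ.*-congˡ {ℚ.toℚᵘ B} j≃)))
  lemma : ∀ j → ((+ 3 ℤ.* j ℤ.* j) ℤ.* + 2 ℤ.+ (+ 1 ℤ.* j) ℤ.* + 2) ℤ.* + 1
              ≡ j ℤ.* (+ 3 ℤ.* j ℤ.+ 1ℤ) ℤ.* + 2
  lemma = ℤ-Solver.solve-∀
  lemma′ : ∀ e → + 2 ℤ.* e ℤ.* + 2 ≡ e ℤ.* + 4
  lemma′ = ℤ-Solver.solve-∀

-- The sign `(-1)^(j+k)` at `j = k + i`: the two copies of `k` contribute an even power.
-1^k+i+k : ∀ k i → -1ℤ ℤ.^ (k + i + k) ≡ -1ℤ ℤ.^ i
-1^k+i+k zero    i = cong (-1ℤ ℤ.^_) (ℕ.+-identityʳ i)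
-1^k+i+k (suc k) i = begin
  -1ℤ ℤ.* -1ℤ ℤ.^ (k + i + suc k)         ≡⟨ cong (λ x → -1ℤ ℤ.* -1ℤ ℤ.^ x) (ℕ.+-suc (k + i) k) ⟩
  -1ℤ ℤ.* (-1ℤ ℤ.* -1ℤ ℤ.^ (k + i + k))   ≡⟨ lemma (-1ℤ ℤ.^ (k + i + k)) ⟩
  -1ℤ ℤ.^ (k + i + k)                     ≡⟨ -1^k+i+k k i ⟩
  -1ℤ ℤ.^ i                               ∎
  where
  open ≡-Reasoning
  lemma : ∀ x → -1ℤ ℤ.* (-1ℤ ℤ.* x) ≡ x
  lemma = ℤ-Solver.solve-∀

term-k+i : ∀ k i n → term (+ 3 / 2) (+ 1 / 2) k (+ (k + i)) n
                     ≡ -1ℤ ℤ.^ i ℤ.* shift (pentagonal (k + i)) 𝟙 n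
term-k+i k i n = cong₂ ℤ._*_ (-1^k+i+k k i) (begin
  (q^ exponent (+ 3 / 2) (+ 1 / 2) (+ m)) n ≡⟨ cong (λ e → (q^ e) n) eq ⟩
  (q^ (+ e / 1)) n                          ≡⟨ q^-shift e n ⟩
  shift e 𝟙 n                               ∎)
  where
  open ≡-Reasoning
  m = k + i
  e = pentagonal m
  eq = exponent-≡ (+ m) e (m[3m+1]≡2*pentagonal m)

-- With `m = k + i`, the exponent at `j = -(m + 1)` exceeds the one at `j = m` by `2 m + 1`, and
-- `∣ j + k ∣ = i + 1` gives the opposite sign. The two terms therefore pair up to one block.
term-[1+k+i] : ∀ k i n → term (+ 3 / 2) (+ 1 / 2) k (ℤ.- + suc (k + i)) n
                         ≡ -1ℤ ℤ.^ suc i ℤ.* shift (pentagonal (k + i) + (2 * (k + i) + 1)) 𝟙 n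
term-[1+k+i] k i n = cong₂ ℤ._*_ (cong (-1ℤ ℤ.^_) abs) (begin
  (q^ exponent (+ 3 / 2) (+ 1 / 2) (ℤ.- + suc m)) n ≡⟨ cong (λ e → (q^ e) n) (exponent-≡ (ℤ.- + suc m) e eq) ⟩
  (q^ (+ e / 1)) n                                  ≡⟨ q^-shift e n ⟩
  shift e 𝟙 n                                       ∎)
  where
  open ≡-Reasoning
  m = k + i
  e = pentagonal m + (2 * m + 1)
  abs : ∣ ℤ.- + suc m ℤ.+ + k ∣ ≡ suc i
  abs = begin
    ∣ k ℤ.⊖ suc (k + i) ∣ ≡⟨ ℤ.∣⊖∣-≤ (ℕ.m≤n⇒m≤1+n (ℕ.m≤m+n k i)) ⟩
    suc (k + i) ∸ k       ≡⟨ cong (_∸ k) (ℕ.+-suc k i) ⟨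
    k + suc i ∸ k         ≡⟨ ℕ.m+n∸m≡n k (suc i) ⟩
    suc i                 ∎
  eq : ℤ.- + suc m ℤ.* (+ 3 ℤ.* (ℤ.- + suc m) ℤ.+ 1ℤ) ≡ + 2 ℤ.* + e
  eq = begin
    ℤ.- (1ℤ ℤ.+ + m) ℤ.* (+ 3 ℤ.* (ℤ.- (1ℤ ℤ.+ + m)) ℤ.+ 1ℤ)
      ≡⟨ lemma (+ m) ⟩
    + m ℤ.* (+ 3 ℤ.* + m ℤ.+ 1ℤ) ℤ.+ + 2 ℤ.* (+ 2 ℤ.* + m ℤ.+ 1ℤ)
      ≡⟨ cong (ℤ._+ + 2 ℤ.* (+ 2 ℤ.* + m ℤ.+ 1ℤ)) (m[3m+1]≡2*pentagonal m) ⟩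
    + 2 ℤ.* + pentagonal m ℤ.+ + 2 ℤ.* (+ 2 ℤ.* + m ℤ.+ 1ℤ)
      ≡⟨ ℤ.*-distribˡ-+ (+ 2) (+ pentagonal m) (+ 2 ℤ.* + m ℤ.+ 1ℤ) ⟨
    + 2 ℤ.* (+ pentagonal m ℤ.+ (+ 2 ℤ.* + m ℤ.+ 1ℤ))
      ≡⟨ cong (λ x → + 2 ℤ.* (+ pentagonal m ℤ.+ (x ℤ.+ 1ℤ))) (ℤ.pos-* 2 m) ⟨
    + 2 ℤ.* + e ∎
    where
    lemma : ∀ m → ℤ.- (1ℤ ℤ.+ m) ℤ.* (+ 3 ℤ.* (ℤ.- (1ℤ ℤ.+ m)) ℤ.+ 1ℤ)
                  ≡ m ℤ.* (+ 3 ℤ.* m ℤ.+ 1ℤ) ℤ.+ + 2 ℤ.* (+ 2 ℤ.* m ℤ.+ 1ℤ)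
    lemma = ℤ-Solver.solve-∀

-- Alternating sums of blocks, and `γ` in terms of them.

-- Up to the factor q^ pentagonal k and truncation at i = N, this is
-- Σ_{i ≥ 0} (-1)ⁱ (q^ pentagonal (k + i)) (1 - q^(2 (k + i) + 1)) f.
alternating : Series → ℕ → ℕ → Series
alternating f k zero    = f ⊖ shift (2 * k + 1) f
alternating f k (suc N) = f ⊖ shift (2 * k + 1) f ⊖ shift (3 * k + 2) (alternating f (suc k) N)

alternating-⊛ : ∀ f g k N → alternating f k N ⊛ g ≗ alternating (f ⊛ g) k N
alternating-⊛ f g k zero n = trans (⊛-distribʳ-⊖ g f (shift (2 * k + 1) f) n)
  (cong (λ x → (f ⊛ g) n ℤ.- x) (shift-⊛ (2 * k + 1) f g n))
alternating-⊛ f g k (suc N) n = trans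
  (⊛-distribʳ-⊖ g (f ⊖ shift (2 * k + 1) f) (shift (3 * k + 2) (alternating f (suc k) N)) n)
  (cong₂ ℤ._-_ (alternating-⊛ f g k zero n)
    (trans (shift-⊛ (3 * k + 2) (alternating f (suc k) N) g n)
           (shift-cong (3 * k + 2) (alternating-⊛ f g (suc k) N) n)))

alternating-cong : ∀ {f g} → f ≗ g → ∀ k N → alternating f k N ≗ alternating g k N
alternating-cong f≗g k zero    n = cong₂ ℤ._-_ (f≗g n) (shift-cong (2 * k + 1) f≗g n)
alternating-cong f≗g k (suc N) n = cong₂ ℤ._-_ (alternating-cong f≗g k zero n)
  (shift-cong (3 * k + 2) (alternating-cong f≗g (suc k) N) n)

alternating-* : ∀ c f k N n → alternating (λ m → c ℤ.* f m) k N n ≡ c ℤ.* alternating f k N n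
alternating-* c f k zero    n = trans
  (cong (λ x → c ℤ.* f n ℤ.- x) (shift-* (2 * k + 1) c f n))
  (lemma c (f n) (shift (2 * k + 1) f n))
  where
  lemma : ∀ c x y → c ℤ.* x ℤ.- c ℤ.* y ≡ c ℤ.* (x ℤ.- y)
  lemma = ℤ-Solver.solve-∀
alternating-* c f k (suc N) n = trans
  (cong₂ ℤ._-_ (alternating-* c f k zero n)
    (trans (shift-cong (3 * k + 2) (alternating-* c f (suc k) N) n)
           (shift-* (3 * k + 2) c (alternating f (suc k) N) n)))
  (lemma c (alternating f k zero n) (shift (3 * k + 2) (alternating f (suc k) N) n))
  where
  lemma : ∀ c x y → c ℤ.* x ℤ.- c ℤ.* y ≡ c ℤ.* (x ℤ.- y)
  lemma = ℤ-Solver.solve-∀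

-- Horner's scheme: since `pentagonal (k + 1) = pentagonal k + 3 k + 2`, everything after the first
-- block carries a further factor `- q^(3 k + 2)`, which is the recursion of `alternating`.
sum-alternating : ∀ k N n →
  ∑[ i ≤ N ] (-1ℤ ℤ.^ toℕ i ℤ.* shift (pentagonal (k + toℕ i)) (𝟙 ⊖ shift (2 * (k + toℕ i) + 1) 𝟙) n)
  ≡ shift (pentagonal k) (alternating 𝟙 k N) n
sum-alternating k zero n = begin
  1ℤ ℤ.* shift (pentagonal (k + 0)) (𝟙 ⊖ shift (2 * (k + 0) + 1) 𝟙) n ℤ.+ 0ℤ
    ≡⟨ trans (ℤ.+-identityʳ _) (ℤ.*-identityˡ _) ⟩
  shift (pentagonal (k + 0)) (𝟙 ⊖ shift (2 * (k + 0) + 1) 𝟙) n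
    ≡⟨ cong (λ m → shift (pentagonal m) (𝟙 ⊖ shift (2 * m + 1) 𝟙) n) (ℕ.+-identityʳ k) ⟩
  shift (pentagonal k) (𝟙 ⊖ shift (2 * k + 1) 𝟙) n ∎
  where open ≡-Reasoning
sum-alternating k (suc N) n = begin
  1ℤ ℤ.* block (k + 0) ℤ.+ ∑[ i ≤ N ] (-1ℤ ℤ.* -1ℤ ℤ.^ toℕ i ℤ.* block (k + suc (toℕ i)))
    ≡⟨ cong₂ ℤ._+_ (trans (ℤ.*-identityˡ _) (cong block (ℕ.+-identityʳ k)))
         (trans (sum-cong-≗ {suc N} λ i → trans (ℤ.*-assoc -1ℤ (-1ℤ ℤ.^ toℕ i) _)
                  (cong (λ m → -1ℤ ℤ.* (-1ℤ ℤ.^ toℕ i ℤ.* block m)) (ℕ.+-suc k (toℕ i))))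
           (sym (*-distribˡ-sum {suc N} -1ℤ (λ i → -1ℤ ℤ.^ toℕ i ℤ.* block (suc k + toℕ i))))) ⟩
  block k ℤ.+ -1ℤ ℤ.* ∑[ i ≤ N ] (-1ℤ ℤ.^ toℕ i ℤ.* block (suc k + toℕ i))
    ≡⟨ cong (λ x → block k ℤ.+ x) (ℤ.-1*i≡-i _) ⟩
  block k ℤ.- ∑[ i ≤ N ] (-1ℤ ℤ.^ toℕ i ℤ.* block (suc k + toℕ i))
    ≡⟨ cong (λ x → block k ℤ.- x) (sum-alternating (suc k) N n) ⟩
  block k ℤ.- shift (3 * k + 2 + pentagonal k) tail n
    ≡⟨ cong (λ x → block k ℤ.- x) (trans
         (cong (λ e → shift e tail n) (ℕ.+-comm (3 * k + 2) (pentagonal k)))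
         (shift-+ (pentagonal k) (3 * k + 2) tail n)) ⟩
  block k ℤ.- shift (pentagonal k) (shift (3 * k + 2) tail) n
    ≡⟨ shift-⊖ (pentagonal k) (𝟙 ⊖ shift (2 * k + 1) 𝟙) (shift (3 * k + 2) tail) n ⟨
  shift (pentagonal k) (alternating 𝟙 k (suc N)) n ∎
  where
  open ≡-Reasoning
  tail = alternating 𝟙 (suc k) N
  block : ℕ → ℤ
  block m = shift (pentagonal m) (𝟙 ⊖ shift (2 * m + 1) 𝟙) n

partialθ-alternating : ∀ k N → partialθ (+ 3 / 2) (+ 1 / 2) k N ≗ shift (pentagonal k) (alternating 𝟙 k N)
partialθ-alternating k N n = trans (sum-cong-≗ {suc N} (λ i → summand≡ (toℕ i))) (sum-alternating k N n)
  where
  summand≡ : ∀ i → term (+ 3 / 2) (+ 1 / 2) k (+ (k + i)) n ℤ.+ term (+ 3 / 2) (+ 1 / 2) k (ℤ.- + suc (k + i)) n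
    ≡ -1ℤ ℤ.^ i ℤ.* shift (pentagonal (k + i)) (𝟙 ⊖ shift (2 * (k + i) + 1) 𝟙) n
  summand≡ i = begin
    term (+ 3 / 2) (+ 1 / 2) k (+ m) n ℤ.+ term (+ 3 / 2) (+ 1 / 2) k (ℤ.- + suc m) n
      ≡⟨ cong₂ ℤ._+_ (term-k+i k i n) (term-[1+k+i] k i n) ⟩
    -1ℤ ℤ.^ i ℤ.* shift e 𝟙 n ℤ.+ -1ℤ ℤ.* -1ℤ ℤ.^ i ℤ.* shift (e + (2 * m + 1)) 𝟙 n
      ≡⟨ lemma (-1ℤ ℤ.^ i) (shift e 𝟙 n) (shift (e + (2 * m + 1)) 𝟙 n) ⟩
    -1ℤ ℤ.^ i ℤ.* (shift e 𝟙 n ℤ.- shift (e + (2 * m + 1)) 𝟙 n)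
      ≡⟨ cong (λ x → -1ℤ ℤ.^ i ℤ.* (shift e 𝟙 n ℤ.- x)) (shift-+ e (2 * m + 1) 𝟙 n) ⟩
    -1ℤ ℤ.^ i ℤ.* (shift e 𝟙 n ℤ.- shift e (shift (2 * m + 1) 𝟙) n)
      ≡⟨ cong (-1ℤ ℤ.^ i ℤ.*_) (shift-⊖ e 𝟙 (shift (2 * m + 1) 𝟙) n) ⟨
    -1ℤ ℤ.^ i ℤ.* shift e (𝟙 ⊖ shift (2 * m + 1) 𝟙) n ∎
    where
    open ≡-Reasoning
    m = k + i
    e = pentagonal m
    lemma : ∀ s x y → s ℤ.* x ℤ.+ -1ℤ ℤ.* s ℤ.* y ≡ s ℤ.* (x ℤ.- y)
    lemma = ℤ-Solver.solve-∀

γ-alternating : ∀ a b c k n → let N = bound (+ 3 / 2) (+ 1 / 2) n in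
  γ a b c (+ 3 / 2) (+ 1 / 2) k n ≡ shift (pentagonal k) (alternating (1/1-q^ a ⊛ 1/1-q^ b ⊛ 1/1-q^ c) k N) n
γ-alternating a b c k n = begin
  (G ⊛ θ A B k) n
    -- The truncation bound grows with the coefficient, so `N`, taken for `n`, serves for every
    -- coefficient of `θ` in the convolution.
    ≡⟨ sum-cong-≗ {suc n} (λ i → cong (G (toℕ i) ℤ.*_) (sym (partialθ-stable A B k (n ∸ toℕ i)
         (ℕ.*-monoʳ-≤ 2 (ℕ.+-monoˡ-≤ 1 (ℕ.m∸n≤m n (toℕ i))))))) ⟩
  (G ⊛ partialθ A B k N) n
    ≡⟨ ⊛-comm G (partialθ A B k N) n ⟩
  (partialθ A B k N ⊛ G) n
    ≡⟨ ⊛-cong {g = G} (partialθ-alternating k N) (λ _ → refl) n ⟩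
  (shift (pentagonal k) (alternating 𝟙 k N) ⊛ G) n
    ≡⟨ shift-⊛ (pentagonal k) (alternating 𝟙 k N) G n ⟩
  shift (pentagonal k) (alternating 𝟙 k N ⊛ G) n
    ≡⟨ shift-cong (pentagonal k) (λ m → trans (alternating-⊛ 𝟙 G k N m)
         (alternating-cong (⊛-identityˡ G) k N m)) n ⟩
  shift (pentagonal k) (alternating G k N) n ∎
  where
  open ≡-Reasoning
  A = + 3 / 2
  B = + 1 / 2
  N = bound A B n
  G = 1/1-q^ a ⊛ 1/1-q^ b ⊛ 1/1-q^ c

-- Quasi-polynomial formula for the coefficients of 1/((1-q)(1-q^b)(1-q^c)).

%-induction : ∀ d .{{_ : ℕ.NonZero d}} (P : ℕ → Set) →
              (∀ {x} → x ℕ.< d → P x) → (∀ x → P x → P (d + x)) → ∀ x → P x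
%-induction d P base step x =
  subst P (sym (trans (m≡m%n+[m/n]*n x d) (ℕ.+-comm (x ℕ.% d) _))) (go (x ℕ./ d))
  where
  go : ∀ q → P (q * d + x ℕ.% d)
  go zero    = base (m%n<n x d)
  go (suc q) = subst P (sym (ℕ.+-assoc d (q * d) (x ℕ.% d))) (step _ (go q))

-- The equation `F = f + q^d F` fixes the coefficients below `d` outright and each later one from
-- the coefficient `d` places before it.
shift-fixpoint-unique : ∀ d .{{_ : ℕ.NonZero d}} {f F H : Series} → F ≗ f ⊕ shift d F →
  (∀ {x} → x ℕ.< d → H x ≡ f x) → (∀ x → H (d + x) ≡ f (d + x) ℤ.+ H x) → F ≗ H
shift-fixpoint-unique d {f} {F} {H} F≗ base step = %-induction d (λ x → F x ≡ H x)
  (λ {x} x<d → trans (F≗ x) (trans (cong (λ y → f x ℤ.+ y) (shift-< F x<d))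
    (trans (ℤ.+-identityʳ (f x)) (sym (base x<d)))))
  (λ x Fx≡Hx → trans (F≗ (d + x)) (trans
    (cong (λ y → f (d + x) ℤ.+ y) (trans (shift-≥ d F x) Fx≡Hx)) (sym (step x))))

1/1-q-const : ∀ n → 1/1-q^ 1 n ≡ 1ℤ
1/1-q-const n = cong (if_then 1ℤ else 0ℤ) (dec-true (1 ∣? n) (1∣ n))

1/[1-q][1-q^b] : ∀ b .{{_ : ℕ.NonZero b}} x → (1/1-q^ 1 ⊛ 1/1-q^ b) x ≡ + suc (x ℕ./ b)
1/[1-q][1-q^b] b x = trans (⊛-comm (1/1-q^ 1) (1/1-q^ b) x)
  (shift-fixpoint-unique b (1/1-q^-⊛ b (1/1-q^ 1))
    (λ {x} x<b → trans (cong (λ y → + suc y) (m<n⇒m/n≡0 x<b)) (sym (1/1-q-const x)))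
    (λ x → trans (cong (λ y → + suc y) (trans (+-distrib-/-∣ˡ {b} x {b} ∣-refl) (cong (_+ x ℕ./ b) (n/n≡1 b))))
      (cong (λ y → y ℤ.+ + suc (x ℕ./ b)) (sym (1/1-q-const (b + x)))))
    x)

entry : List ℕ → ℕ → ℕ
entry []       _       = 0
entry (ψ ∷ _)  zero    = ψ
entry (_ ∷ ψs) (suc r) = entry ψs r

-- With `s = 1 + b + c` and a suitable periodic `ψ`, this is `2 b c` times the number of partitions
-- of `x` into parts 1, `b` and `c`; the scaling keeps all values in ℕ.
quadratic : ℕ → (ℕ → ℕ) → ℕ → ℕ
quadratic s ψ x = x * (x + s) + ψ x

periodic : List ℕ → (m : ℕ) .{{_ : ℕ.NonZero m}} → ℕ → ℕ
periodic ψs m x = entry ψs (x ℕ.% m)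

module _ (b c : ℕ) .{{_ : ℕ.NonZero b}} .{{_ : ℕ.NonZero c}} .{{_ : ℕ.NonZero (b * c)}} (ψs : List ℕ) where

  private
    s = 1 + b + c
    ψ = periodic ψs (b * c)
    h = quadratic s ψ

  -- Both sides satisfy the recursion of `1/1-q^ c` with inhomogeneity `2 b c (⌊x/b⌋ + 1)`. The
  -- first hypothesis starts it; the second is what remains of the recursion for `h` once the
  -- polynomial terms cancel.
  quasipolynomial :
    (∀ {x} → x ℕ.< c → h x ≡ 2 * b * c * suc (x ℕ./ b)) →
    (∀ {r} → r ℕ.< b * c → ψ (c + r) + c * (c + s) + 2 * c * ((c + r) ℕ.% b) ≡ entry ψs r + 2 * c * (c + b)) →
    ∀ x → + (2 * b * c) ℤ.* (1/1-q^ 1 ⊛ 1/1-q^ b ⊛ 1/1-q^ c) x ≡ + h x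
  quasipolynomial base step = shift-fixpoint-unique c {λ x → + (K * suc (x ℕ./ b))} fixpoint
    (λ x<c → cong +_ (base x<c)) (λ x → cong +_ (step′ x))
    where
    K = 2 * b * c
    open ≡-Reasoning
    p = 1/1-q^ 1 ⊛ 1/1-q^ b
    G = p ⊛ 1/1-q^ c
    fixpoint : (λ x → + K ℤ.* G x) ≗ (λ x → + (K * suc (x ℕ./ b))) ⊕ shift c (λ x → + K ℤ.* G x)
    fixpoint x = begin
      + K ℤ.* G x
        ≡⟨ cong (+ K ℤ.*_) (trans (⊛-comm p (1/1-q^ c) x) (1/1-q^-⊛ c p x)) ⟩
      + K ℤ.* (p x ℤ.+ shift c (1/1-q^ c ⊛ p) x)
        ≡⟨ ℤ.*-distribˡ-+ (+ K) (p x) _ ⟩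
      + K ℤ.* p x ℤ.+ + K ℤ.* shift c (1/1-q^ c ⊛ p) x
        ≡⟨ cong₂ ℤ._+_
             (trans (cong (+ K ℤ.*_) (1/[1-q][1-q^b] b x)) (sym (ℤ.pos-* K (suc (x ℕ./ b)))))
             (trans (cong (+ K ℤ.*_) (shift-cong c (⊛-comm (1/1-q^ c) p) x)) (sym (shift-* c (+ K) G x))) ⟩
      + (K * suc (x ℕ./ b)) ℤ.+ shift c (λ x → + K ℤ.* G x) x ∎

    step′ : ∀ x → h (c + x) ≡ K * suc ((c + x) ℕ./ b) + h x
    -- Writing `c + x = w + z b` turns `2 b c (z + 1)` into `2 c (c + x - w + b)`. The amount added
    -- to both sides brings in `residue` without subtraction.
    step′ x = ℕ.+-cancelʳ-≡ (c * (c + s) + 2 * c * w) _ _ (begin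
      h (c + x) + (c * (c + s) + 2 * c * w)
        ≡⟨ lemma₁ c x s (ψ (c + x)) w ⟩
      (c + x) * (c + x + s) + (ψ (c + x) + c * (c + s) + 2 * c * w)
        ≡⟨ cong (λ y → (c + x) * (c + x + s) + y) residue ⟩
      (c + x) * (c + x + s) + (ψ x + 2 * c * (c + b))
        ≡⟨ lemma₂ c x b (ψ x) s ⟩
      x * (x + s) + ψ x + 2 * c * b + 2 * c * (c + x) + c * (c + s)
        ≡⟨ cong (λ y → x * (x + s) + ψ x + 2 * c * b + 2 * c * y + c * (c + s)) (m≡m%n+[m/n]*n (c + x) b) ⟩
      x * (x + s) + ψ x + 2 * c * b + 2 * c * (w + z * b) + c * (c + s)
        ≡⟨ lemma₃ b c (h x) w z (c * (c + s)) ⟩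
      K * suc z + h x + (c * (c + s) + 2 * c * w) ∎)
      where
      w = (c + x) ℕ.% b
      z = (c + x) ℕ./ b
      r = x ℕ.% (b * c)
      c+x≡c+r : (c + x) ℕ.% (b * c) ≡ (c + r) ℕ.% (b * c)
      c+x≡c+r = begin
        (c + x) ℕ.% (b * c)
          ≡⟨ %-distribˡ-+ c x (b * c) ⟩
        (c ℕ.% (b * c) + r) ℕ.% (b * c)
          ≡⟨ cong (λ y → (c ℕ.% (b * c) + y) ℕ.% (b * c)) (m%n%n≡m%n x (b * c)) ⟨
        (c ℕ.% (b * c) + r ℕ.% (b * c)) ℕ.% (b * c)
          ≡⟨ %-distribˡ-+ c r (b * c) ⟨
        (c + r) ℕ.% (b * c) ∎
      -- As `b` divides `b c`, reduction modulo `b` factors through reduction modulo `b c`; hence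
      -- checking `step` for `r < b c` is enough.
      w≡ : w ≡ (c + r) ℕ.% b
      w≡ = begin
        (c + x) ℕ.% b               ≡⟨ m∣n⇒o%n%m≡o%m b (b * c) (c + x) (m∣m*n c) ⟨
        (c + x) ℕ.% (b * c) ℕ.% b   ≡⟨ cong (ℕ._% b) c+x≡c+r ⟩
        (c + r) ℕ.% (b * c) ℕ.% b   ≡⟨ m∣n⇒o%n%m≡o%m b (b * c) (c + r) (m∣m*n c) ⟩
        (c + r) ℕ.% b               ∎
      residue : ψ (c + x) + c * (c + s) + 2 * c * w ≡ ψ x + 2 * c * (c + b)
      residue = begin
        ψ (c + x) + c * (c + s) + 2 * c * w
          ≡⟨ cong₂ (λ y w → entry ψs y + c * (c + s) + 2 * c * w) c+x≡c+r w≡ ⟩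
        ψ (c + r) + c * (c + s) + 2 * c * ((c + r) ℕ.% b)
          ≡⟨ step (m%n<n x (b * c)) ⟩
        ψ x + 2 * c * (c + b) ∎
      lemma₁ : ∀ c x s ψ w → (c + x) * (c + x + s) + ψ + (c * (c + s) + 2 * c * w) ≡
               (c + x) * (c + x + s) + (ψ + c * (c + s) + 2 * c * w)
      lemma₁ = ℕ-Solver.solve-∀
      lemma₂ : ∀ c x b ψ s → (c + x) * (c + x + s) + (ψ + 2 * c * (c + b)) ≡
               x * (x + s) + ψ + 2 * c * b + 2 * c * (c + x) + c * (c + s)
      lemma₂ = ℕ-Solver.solve-∀
      lemma₃ : ∀ b c y w z v → y + 2 * c * b + 2 * c * (w + z * b) + v ≡
               2 * b * c * (1 + z) + y + (v + 2 * c * w)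
      lemma₃ = ℕ-Solver.solve-∀

-- Elementary inequalities.

≤-from-≡ : ∀ {m n} o → m + o ≡ n → m ℕ.≤ n
≤-from-≡ {m} o refl = ℕ.m≤m+n m o

∣m-n∣≤ : ∀ m n o → m ℕ.≤ n + o → n ℕ.≤ m + o → ∣ + m ℤ.- + n ∣ ℕ.≤ o
∣m-n∣≤ m n o m≤n+o n≤m+o rewrite ℤ.m-n≡m⊖n m n with ℕ.≤-total m n
... | inj₁ m≤n = subst (ℕ._≤ o) (sym (ℤ.∣⊖∣-≤ m≤n)) (ℕ.m≤n+o⇒m∸n≤o n m n≤m+o)
... | inj₂ n≤m = subst (ℕ._≤ o) (trans (sym (ℤ.∣⊖∣-≤ n≤m)) (ℤ.∣m⊖n∣≡∣n⊖m∣ n m)) (ℕ.m≤n+o⇒m∸n≤o m n m≤n+o)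

-- Turns an estimate into a sign: an error no larger than the main term `n` cannot push `i` below 0.
∣i-n∣≤n⇒0≤i : ∀ i n → ∣ i ℤ.- + n ∣ ℕ.≤ n → 0ℤ ≤ i
∣i-n∣≤n⇒0≤i (+ m)    n       _  = +≤+ z≤n
∣i-n∣≤n⇒0≤i -[1+ m ] (suc n) le = contradiction (s≤s (ℕ.m≤n+m n m)) (ℕ.<⇒≱ le)

2*m*n≤m²+n² : ∀ m n → 2 * m * n ℕ.≤ m * m + n * n
2*m*n≤m²+n² m n with ℕ.≤-total m n
... | inj₁ m≤n with ℕ.m≤n⇒∃[o]m+o≡n m≤n
...   | o , refl = ≤-from-≡ (o * o) (lemma m o)
  where
  lemma : ∀ m o → 2 * m * (m + o) + o * o ≡ m * m + (m + o) * (m + o)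
  lemma = ℕ-Solver.solve-∀
2*m*n≤m²+n² m n | inj₂ n≤m with ℕ.m≤n⇒∃[o]m+o≡n n≤m
...   | o , refl = ≤-from-≡ (o * o) (lemma n o)
  where
  lemma : ∀ n o → 2 * (n + o) * n + o * o ≡ (n + o) * (n + o) + n * n
  lemma = ℕ-Solver.solve-∀

-- Locating the last block that reaches a coefficient.

-- pentagonal (k + d) = pentagonal k + offset k d
offset : ℕ → ℕ → ℕ
offset k zero    = 0
offset k (suc d) = 3 * k + 2 + offset (suc k) d

2*offset : ∀ k d → 2 * offset k d ≡ d * (6 * k + 3 * d + 1)
2*offset k zero    = refl
2*offset k (suc d) = begin
  2 * (3 * k + 2 + offset (suc k) d)                    ≡⟨ ℕ.*-distribˡ-+ 2 (3 * k + 2) _ ⟩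
  2 * (3 * k + 2) + 2 * offset (suc k) d                ≡⟨ cong (λ x → 2 * (3 * k + 2) + x) (2*offset (suc k) d) ⟩
  2 * (3 * k + 2) + d * (6 * suc k + 3 * d + 1)         ≡⟨ lemma k d ⟩
  suc d * (6 * k + 3 * suc d + 1)                       ∎
  where
  open ≡-Reasoning
  lemma : ∀ k d → 2 * (3 * k + 2) + d * (6 * (1 + k) + 3 * d + 1) ≡ (1 + d) * (6 * k + 3 * (1 + d) + 1)
  lemma = ℕ-Solver.solve-∀

-- Remove `3 k + 2`, `3 (k + 1) + 2`, ... greedily: `d` steps fit and `t` remains, so `k + d` is the
-- last block that reaches `x`. The bound `d ≤ x` permits comparison with the truncation index;
-- `fuel` makes the recursion structural.
offset-view : ∀ k x → ∃[ d ] ∃[ t ] t ℕ.< 3 * (k + d) + 2 × x ≡ offset k d + t × d ℕ.≤ x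
offset-view k x = go x k x ℕ.≤-refl
  where
  go : ∀ fuel k x → x ℕ.≤ fuel → ∃[ d ] ∃[ t ] t ℕ.< 3 * (k + d) + 2 × x ≡ offset k d + t × d ℕ.≤ x
  go fuel k x x≤fuel with x ℕ.<? 3 * k + 2
  ... | yes x<3k+2 =
    0 , x , subst (λ m → x ℕ.< 3 * m + 2) (sym (ℕ.+-identityʳ k)) x<3k+2 , refl , z≤n
  ... | no x≮3k+2 with ℕ.m≤n⇒∃[o]m+o≡n (ℕ.≮⇒≥ x≮3k+2)
  go zero k _ x≤fuel | no _ | y , refl =
    contradiction (subst (λ z → z + y ℕ.≤ 0) (ℕ.+-comm (3 * k) 2) x≤fuel) ℕ.n≮0
  go (suc fuel) k _ x≤fuel | no _ | y , refl
    with go fuel (suc k) y (ℕ.≤-trans (ℕ.m≤n+m y (1 + 3 * k))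
           (ℕ.≤-pred (subst (λ z → z + y ℕ.≤ suc fuel) (ℕ.+-comm (3 * k) 2) x≤fuel)))
  ... | d , t , t< , refl , d≤y = suc d , t
      , subst (λ m → t ℕ.< 3 * m + 2) (sym (ℕ.+-suc k d)) t<
      , sym (ℕ.+-assoc (3 * k + 2) (offset (suc k) d) t)
      , ℕ.≤-trans (s≤s d≤y) (ℕ.+-monoˡ-≤ y (ℕ.≤-trans (s≤s z≤n) (ℕ.m≤n+m 2 (3 * k))))

-- Block `k + d + 1` starts `3 (k + d) + 2` places after block `k + d`, so neither it nor any later
-- block reaches the coefficient.
alternating-stable : ∀ f k d N {t} → t ℕ.< 3 * (k + d) + 2 → d ℕ.≤ N →
  alternating f k N (offset k d + t) ≡ alternating f k d (offset k d + t)
alternating-stable f k zero zero    t< _ = refl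
alternating-stable f k zero (suc N) {t} t< _ = begin
  alternating f k zero t ℤ.- shift (3 * k + 2) (alternating f (suc k) N) t
    ≡⟨ cong (λ y → alternating f k zero t ℤ.- y) (shift-< (alternating f (suc k) N)
         (subst (λ m → t ℕ.< 3 * m + 2) (ℕ.+-identityʳ k) t<)) ⟩
  alternating f k zero t ℤ.- 0ℤ ≡⟨ ℤ.+-identityʳ _ ⟩
  alternating f k zero t        ∎
  where open ≡-Reasoning
alternating-stable f k (suc d) (suc N) {t} t< (s≤s d≤N) =
  cong (λ y → alternating f k zero (offset k (suc d) + t) ℤ.- y) (begin
    shift (3 * k + 2) (alternating f (suc k) N) (offset k (suc d) + t) ≡⟨ at N ⟩
    alternating f (suc k) N (offset (suc k) d + t)
      ≡⟨ alternating-stable f (suc k) d N (subst (λ m → t ℕ.< 3 * m + 2) (ℕ.+-suc k d) t<) d≤N ⟩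
    alternating f (suc k) d (offset (suc k) d + t)                     ≡⟨ at d ⟨
    shift (3 * k + 2) (alternating f (suc k) d) (offset k (suc d) + t) ∎)
  where
  open ≡-Reasoning
  at : ∀ N → shift (3 * k + 2) (alternating f (suc k) N) (offset k (suc d) + t) ≡
             alternating f (suc k) N (offset (suc k) d + t)
  at N = trans
    (cong (shift (3 * k + 2) (alternating f (suc k) N)) (ℕ.+-assoc (3 * k + 2) (offset (suc k) d) t))
    (shift-≥ (3 * k + 2) (alternating f (suc k) N) (offset (suc k) d + t))

-- Main term and error of the alternating sum.

-- Sufficient for positivity with u = 1 + b + c + β, by radius≤centre below.
Large : ℕ → ℕ → ℕ → Set
Large u k d = 2 * u + 6 * k + 4 * d + 1 ℕ.≤ 6 * k * d + 5 * (k * k)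

-- Raising `k` by `j` and `d` by `f` adds `6 j + 4 f` on the left, while the product `6 k d` on the
-- right gains at least `6 j + 6 f` because `k` and `d` are at least 1.
Large-mono : ∀ {u u′ k k′ d d′} → u′ ℕ.≤ u → 1 ℕ.≤ k → k ℕ.≤ k′ → 1 ℕ.≤ d → d ℕ.≤ d′ →
             Large u k d → Large u′ k′ d′
Large-mono {u} {u′} u′≤u 1≤k k≤k′ 1≤d d≤d′ large
  with ℕ.m≤n⇒∃[o]m+o≡n 1≤k | ℕ.m≤n⇒∃[o]m+o≡n k≤k′ | ℕ.m≤n⇒∃[o]m+o≡n 1≤d | ℕ.m≤n⇒∃[o]m+o≡n d≤d′
... | i , refl | j , refl | e , refl | f , refl = begin
  2 * u′ + 6 * (k + j) + 4 * (d + f) + 1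
    ≤⟨ ℕ.+-monoˡ-≤ 1 (ℕ.+-monoˡ-≤ (4 * (d + f)) (ℕ.+-monoˡ-≤ (6 * (k + j)) (ℕ.*-monoʳ-≤ 2 u′≤u))) ⟩
  2 * u + 6 * (k + j) + 4 * (d + f) + 1
    ≡⟨ lemma₁ u k j d f ⟩
  2 * u + 6 * k + 4 * d + 1 + (6 * j + 4 * f)
    ≤⟨ ℕ.+-monoˡ-≤ (6 * j + 4 * f) large ⟩
  6 * k * d + 5 * (k * k) + (6 * j + 4 * f)
    ≤⟨ ≤-from-≡ (6 * j * e + 6 * i * f + 2 * f + 6 * j * f + 5 * (2 * k * j + j * j)) (lemma₂ i j e f) ⟩
  6 * (k + j) * (d + f) + 5 * ((k + j) * (k + j)) ∎
  where
  open ℕ.≤-Reasoning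
  k = 1 + i
  d = 1 + e
  lemma₁ : ∀ u k j d f → 2 * u + 6 * (k + j) + 4 * (d + f) + 1 ≡ 2 * u + 6 * k + 4 * d + 1 + (6 * j + 4 * f)
  lemma₁ = ℕ-Solver.solve-∀
  lemma₂ : ∀ i j e f → let k = 1 + i ; d = 1 + e in
    6 * k * d + 5 * (k * k) + (6 * j + 4 * f) + (6 * j * e + 6 * i * f + 2 * f + 6 * j * f + 5 * (2 * k * j + j * j)) ≡
    6 * (k + j) * (d + f) + 5 * ((k + j) * (k + j))
  lemma₂ = ℕ-Solver.solve-∀

module _ (s β : ℕ) (ψ : ℕ → ℕ) (ψ≤β : ∀ x → ψ x ℕ.≤ β) where

  private
    H : Series
    H x = + quadratic s ψ x

    quadratic-≥ : ∀ k r → shift (2 * k + 1) H (2 * k + 1 + r) ≡ H r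
    quadratic-≥ k r = shift-≥ (2 * k + 1) H r

  -- centre k x is C k of the header.
  centre : ℕ → ℕ → ℕ
  centre k x = k * (2 * x + k + s + 2)

  -- Error allowed for the last block. `2 m² + m (s + 2)` is the lower error, through
  -- `2 k t ≤ k² + t²`, before the subtracted half of the block sets in; adding `1 + s + β` suffices
  -- for the other estimates.
  radius : ℕ → ℕ
  radius m = 2 * (m * m) + m * (s + 2) + (1 + s) + β

  ∣block-centre∣≤radius : ∀ k t → t ℕ.< 3 * k + 2 → ∣ alternating H k 0 t ℤ.- + centre k t ∣ ℕ.≤ radius k
  ∣block-centre∣≤radius k t t< with t ℕ.<? 2 * k + 1
  ... | yes t<2k+1 = subst (λ i → ∣ i ℤ.- + centre k t ∣ ℕ.≤ radius k)
      (sym (trans (cong (λ y → H t ℤ.- y) (shift-< H t<2k+1)) (ℤ.+-identityʳ (H t))))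
      (∣m-n∣≤ (quadratic s ψ t) (centre k t) (radius k) upper lower)
    where
    open ℕ.≤-Reasoning
    t≤2k : t ℕ.≤ 2 * k
    t≤2k = ℕ.≤-pred (subst (t ℕ.<_) (ℕ.+-comm (2 * k) 1) t<2k+1)
    upper : quadratic s ψ t ℕ.≤ centre k t + radius k
    upper = begin
      t * (t + s) + ψ t               ≡⟨ cong (_+ ψ t) (ℕ.*-distribˡ-+ t t s) ⟩
      t * t + t * s + ψ t             ≤⟨ ℕ.+-mono-≤ (ℕ.+-mono-≤ (ℕ.*-monoʳ-≤ t t≤2k) (ℕ.*-monoˡ-≤ s t≤2k)) (ψ≤β t) ⟩
      t * (2 * k) + 2 * k * s + β     ≤⟨ ≤-from-≡ (3 * (k * k) + 4 * k + (1 + s)) (lemma k t s β) ⟩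
      centre k t + radius k           ∎
      where
      lemma : ∀ k t s β → t * (2 * k) + 2 * k * s + β + (3 * (k * k) + 4 * k + (1 + s)) ≡
        k * (2 * t + k + s + 2) + (2 * (k * k) + k * (s + 2) + (1 + s) + β)
      lemma = ℕ-Solver.solve-∀
    lower : centre k t ℕ.≤ quadratic s ψ t + radius k
    lower = begin
      centre k t                                            ≡⟨ lemma₁ k t s ⟩
      2 * k * t + (k * k + k * (s + 2))                     ≤⟨ ℕ.+-monoˡ-≤ _ (2*m*n≤m²+n² k t) ⟩
      k * k + t * t + (k * k + k * (s + 2))                 ≤⟨ ≤-from-≡ (t * s + ψ t + (1 + s) + β) (lemma₂ k t s β (ψ t)) ⟩
      quadratic s ψ t + radius k                            ∎
      where
      lemma₁ : ∀ k t s → k * (2 * t + k + s + 2) ≡ 2 * k * t + (k * k + k * (s + 2))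
      lemma₁ = ℕ-Solver.solve-∀
      lemma₂ : ∀ k t s β ψ → k * k + t * t + (k * k + k * (s + 2)) + (t * s + ψ + (1 + s) + β) ≡
        t * (t + s) + ψ + (2 * (k * k) + k * (s + 2) + (1 + s) + β)
      lemma₂ = ℕ-Solver.solve-∀
  ... | no t≮2k+1 with ℕ.m≤n⇒∃[o]m+o≡n (ℕ.≮⇒≥ t≮2k+1)
  ...   | r , refl = subst (λ i → ∣ i ∣ ℕ.≤ radius k) (sym block)
      (∣m-n∣≤ (quadratic s ψ t) (quadratic s ψ r + centre k t) (radius k) upper lower)
    where
    open ℕ.≤-Reasoning
    block : alternating H k 0 t ℤ.- + centre k t ≡ H t ℤ.- + (quadratic s ψ r + centre k t)
    block = trans (cong (λ y → H t ℤ.- y ℤ.- + centre k t) (quadratic-≥ k r)) (lemma (H t) (H r) (+ centre k t))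
      where
      lemma : ∀ x y z → x ℤ.- y ℤ.- z ≡ x ℤ.- (y ℤ.+ z)
      lemma = ℤ-Solver.solve-∀
    r≤k : r ℕ.≤ k
    r≤k = ℕ.≤-pred (ℕ.+-cancelˡ-< (2 * k + 1) r (suc k) (subst (t ℕ.<_) (lemma k) t<))
      where
      lemma : ∀ k → 3 * k + 2 ≡ 2 * k + 1 + (1 + k)
      lemma = ℕ-Solver.solve-∀
    -- The block exceeds `centre k t` by `(k + 1) (2 r + 1 + s - k)` plus a difference of `ψ`
    -- values. The product is the telescoping term `C (k + 1)`, continued to the negative argument
    -- `t - (3 k + 2)`; the terms are arranged to stay in ℕ.
    main : ∀ ψ₁ ψ₂ → t * (t + s) + ψ₁ + ((k + 1) * k + ψ₂) ≡
                     (r * (r + s) + ψ₂ + centre k t) + ((k + 1) * (2 * r + 1 + s) + ψ₁)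
    main = lemma k r s
      where
      lemma : ∀ k r s ψ₁ ψ₂ → let t = 2 * k + 1 + r in t * (t + s) + ψ₁ + ((k + 1) * k + ψ₂) ≡
        (r * (r + s) + ψ₂ + k * (2 * t + k + s + 2)) + ((k + 1) * (2 * r + 1 + s) + ψ₁)
      lemma = ℕ-Solver.solve-∀
    upper : quadratic s ψ t ℕ.≤ quadratic s ψ r + centre k t + radius k
    upper = ℕ.+-cancelʳ-≤ ((k + 1) * k + ψ r) _ _ (begin
      quadratic s ψ t + ((k + 1) * k + ψ r)
        ≡⟨ main (ψ t) (ψ r) ⟩
      quadratic s ψ r + centre k t + ((k + 1) * (2 * r + 1 + s) + ψ t)
        ≤⟨ ℕ.+-monoʳ-≤ (quadratic s ψ r + centre k t)
             (ℕ.+-mono-≤ (ℕ.*-monoʳ-≤ (k + 1) (ℕ.+-monoˡ-≤ s (ℕ.+-monoˡ-≤ 1 (ℕ.*-monoʳ-≤ 2 r≤k)))) (ψ≤β t)) ⟩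
      quadratic s ψ r + centre k t + ((k + 1) * (2 * k + 1 + s) + β)
        ≤⟨ ≤-from-≡ (k * k + ψ r) (lemma (quadratic s ψ r + centre k t) k s β (ψ r)) ⟩
      quadratic s ψ r + centre k t + radius k + ((k + 1) * k + ψ r) ∎)
      where
      lemma : ∀ z k s β ψ → z + ((k + 1) * (2 * k + 1 + s) + β) + (k * k + ψ) ≡
        z + (2 * (k * k) + k * (s + 2) + (1 + s) + β) + ((k + 1) * k + ψ)
      lemma = ℕ-Solver.solve-∀
    lower : quadratic s ψ r + centre k t ℕ.≤ quadratic s ψ t + radius k
    lower = begin
      quadratic s ψ r + centre k t
        ≤⟨ ℕ.m≤m+n _ _ ⟩
      quadratic s ψ r + centre k t + ((k + 1) * (2 * r + 1 + s) + ψ t)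
        ≡⟨ main (ψ t) (ψ r) ⟨
      quadratic s ψ t + ((k + 1) * k + ψ r)
        ≤⟨ ℕ.+-monoʳ-≤ (quadratic s ψ t) (ℕ.+-monoʳ-≤ ((k + 1) * k) (ψ≤β r)) ⟩
      quadratic s ψ t + ((k + 1) * k + β)
        ≤⟨ ℕ.+-monoʳ-≤ (quadratic s ψ t) (≤-from-≡ (k * k + k * (s + 1) + (1 + s)) (lemma k s β)) ⟩
      quadratic s ψ t + radius k ∎
      where
      lemma : ∀ k s β → (k + 1) * k + β + (k * k + k * (s + 1) + (1 + s)) ≡
        2 * (k * k) + k * (s + 2) + (1 + s) + β
      lemma = ℕ-Solver.solve-∀

  -- Telescoping by induction on `d`. With `y = x - (3 k + 2)`, the quadratic part of the first
  -- block is `centre k x + centre (k + 1) y`, and the second summand is the main term of the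
  -- subtracted rest. Each complete block thus adds only a difference of two `ψ` values, at most
  -- `β`, to the error.
  ∣alternating-centre∣≤ : ∀ k d t → t ℕ.< 3 * (k + d) + 2 →
    let x = offset k d + t in ∣ alternating H k d x ℤ.- + centre k x ∣ ℕ.≤ d * β + radius (k + d)
  ∣alternating-centre∣≤ k zero t t< = subst (λ m → ∣ alternating H k 0 t ℤ.- + centre k t ∣ ℕ.≤ radius m)
    (sym (ℕ.+-identityʳ k)) (∣block-centre∣≤radius k t (subst (λ m → t ℕ.< 3 * m + 2) (ℕ.+-identityʳ k) t<))
  ∣alternating-centre∣≤ k (suc d) t t< = let open ℕ.≤-Reasoning in begin
    ∣ alternating H k (suc d) (offset k (suc d) + t) ℤ.- + centre k (offset k (suc d) + t) ∣
      ≡⟨ cong (λ x → ∣ alternating H k (suc d) x ℤ.- + centre k x ∣) (ℕ.+-assoc (3 * k + 2) (offset (suc k) d) t) ⟩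
    ∣ alternating H k (suc d) x ℤ.- + centre k x ∣
      ≡⟨ cong ∣_∣ difference ⟩
    ∣ (+ ψ x ℤ.- + ψ z) ℤ.- (alternating H (suc k) d y ℤ.- + centre (suc k) y) ∣
      ≤⟨ ℤ.∣i-j∣≤∣i∣+∣j∣ (+ ψ x ℤ.- + ψ z) _ ⟩
    ∣ + ψ x ℤ.- + ψ z ∣ + ∣ alternating H (suc k) d y ℤ.- + centre (suc k) y ∣
      ≤⟨ ℕ.+-mono-≤
           (∣m-n∣≤ (ψ x) (ψ z) β (ℕ.≤-trans (ψ≤β x) (ℕ.m≤n+m β (ψ z)))
             (ℕ.≤-trans (ψ≤β z) (ℕ.m≤n+m β (ψ x))))
           (∣alternating-centre∣≤ (suc k) d t (subst (λ m → t ℕ.< 3 * m + 2) (ℕ.+-suc k d) t<)) ⟩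
    β + (d * β + radius (suc (k + d)))
      ≡⟨ ℕ.+-assoc β (d * β) _ ⟨
    suc d * β + radius (suc (k + d))
      ≡⟨ cong (λ m → suc d * β + radius m) (ℕ.+-suc k d) ⟨
    suc d * β + radius (k + suc d) ∎
    where
    y = offset (suc k) d + t
    x = 3 * k + 2 + y
    z = k + 1 + y
    rest = alternating H (suc k) d y
    x≡ : x ≡ 2 * k + 1 + z
    x≡ = lemma k y
      where
      lemma : ∀ k y → 3 * k + 2 + y ≡ 2 * k + 1 + (k + 1 + y)
      lemma = ℕ-Solver.solve-∀
    centres : quadratic s ψ x + ψ z ≡ quadratic s ψ z + centre k x + centre (suc k) y + ψ x
    centres = lemma k y s (ψ x) (ψ z)
      where
      lemma : ∀ k y s ψ₁ ψ₂ → let x = 3 * k + 2 + y ; z = k + 1 + y in x * (x + s) + ψ₁ + ψ₂ ≡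
        z * (z + s) + ψ₂ + k * (2 * x + k + s + 2) + (1 + k) * (2 * y + (1 + k) + s + 2) + ψ₁
      lemma = ℕ-Solver.solve-∀
    difference : alternating H k (suc d) x ℤ.- + centre k x ≡
                 (+ ψ x ℤ.- + ψ z) ℤ.- (rest ℤ.- + centre (suc k) y)
    difference = begin
      H x ℤ.- shift (2 * k + 1) H x ℤ.- shift (3 * k + 2) (alternating H (suc k) d) x ℤ.- + centre k x
        ≡⟨ cong₂ (λ i j → H x ℤ.- i ℤ.- j ℤ.- + centre k x)
             (trans (cong (shift (2 * k + 1) H) x≡) (quadratic-≥ k z))
             (shift-≥ (3 * k + 2) (alternating H (suc k) d) y) ⟩
      H x ℤ.- H z ℤ.- rest ℤ.- + centre k x
        -- Adding `ψ z` to both sides of the difference makes the first part the natural number on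
        -- the left of `centres`.
        ≡⟨ lemma₁ (H x) (H z) rest (+ centre k x) (+ ψ z) ⟩
      (H x ℤ.+ + ψ z) ℤ.- (H z ℤ.+ rest ℤ.+ + centre k x ℤ.+ + ψ z)
        ≡⟨ cong (λ i → + i ℤ.- (H z ℤ.+ rest ℤ.+ + centre k x ℤ.+ + ψ z)) centres ⟩
      (H z ℤ.+ + centre k x ℤ.+ + centre (suc k) y ℤ.+ + ψ x) ℤ.- (H z ℤ.+ rest ℤ.+ + centre k x ℤ.+ + ψ z)
        ≡⟨ lemma₂ (H z) (+ centre k x) (+ centre (suc k) y) (+ ψ x) rest (+ ψ z) ⟩
      (+ ψ x ℤ.- + ψ z) ℤ.- (rest ℤ.- + centre (suc k) y) ∎
      where
      open ≡-Reasoning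
      lemma₁ : ∀ a b r c p → a ℤ.- b ℤ.- r ℤ.- c ≡ (a ℤ.+ p) ℤ.- (b ℤ.+ r ℤ.+ c ℤ.+ p)
      lemma₁ = ℤ-Solver.solve-∀
      lemma₂ : ∀ b c c′ p r p′ → (b ℤ.+ c ℤ.+ c′ ℤ.+ p) ℤ.- (b ℤ.+ r ℤ.+ c ℤ.+ p′) ≡ (p ℤ.- p′) ℤ.- (r ℤ.- c′)
      lemma₂ = ℤ-Solver.solve-∀

  -- The difference of the two sides of the conclusion, doubled, is
  -- (d + 1) (6 k d + 5 k² - 2 (s + β) - 6 k - 4 d - 1) + (7 k² - 6 k + 1) (d - 1) + 4 k t.
  radius≤centre : ∀ {k d} t → 1 ℕ.≤ k → 1 ℕ.≤ d → Large (s + β) k d →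
    d * β + radius (k + d) ℕ.≤ centre k (offset k d + t)
  radius≤centre t 1≤k 1≤d large with ℕ.m≤n⇒∃[o]m+o≡n 1≤k | ℕ.m≤n⇒∃[o]m+o≡n 1≤d
  ... | j , refl | e , refl = ℕ.*-cancelˡ-≤ 2 (ℕ.+-cancelʳ-≤ ((d + 1) * (6 * k * d + 5 * (k * k))) _ _ (begin
    2 * (d * β + radius (k + d)) + (d + 1) * (6 * k * d + 5 * (k * k))
      ≤⟨ ≤-from-≡ ((7 * (j * j) + 8 * j + 2) * e + 4 * k * t) (lemma j e t s β) ⟩
    k * (2 * (d * (6 * k + 3 * d + 1)) + 4 * t + 2 * k + 2 * s + 4) + (d + 1) * (2 * (s + β) + 6 * k + 4 * d + 1)
      ≤⟨ ℕ.+-monoʳ-≤ _ (ℕ.*-monoʳ-≤ (d + 1) large) ⟩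
    k * (2 * (d * (6 * k + 3 * d + 1)) + 4 * t + 2 * k + 2 * s + 4) + (d + 1) * (6 * k * d + 5 * (k * k))
      ≡⟨ cong (_+ (d + 1) * (6 * k * d + 5 * (k * k)))
           (trans (cong (λ x → k * (2 * x + 4 * t + 2 * k + 2 * s + 4)) (sym (2*offset k d)))
             (lemma′ k (offset k d) t s)) ⟩
    2 * centre k (offset k d + t) + (d + 1) * (6 * k * d + 5 * (k * k)) ∎))
    where
    open ℕ.≤-Reasoning
    k = 1 + j
    d = 1 + e
    lemma : ∀ j e t s β → let k = 1 + j ; d = 1 + e in
      2 * (d * β + (2 * ((k + d) * (k + d)) + (k + d) * (s + 2) + (1 + s) + β)) + (d + 1) * (6 * k * d + 5 * (k * k))
        + ((7 * (j * j) + 8 * j + 2) * e + 4 * k * t) ≡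
      k * (2 * (d * (6 * k + 3 * d + 1)) + 4 * t + 2 * k + 2 * s + 4) + (d + 1) * (2 * (s + β) + 6 * k + 4 * d + 1)
    lemma = ℕ-Solver.solve-∀
    lemma′ : ∀ k o t s → k * (2 * (2 * o) + 4 * t + 2 * k + 2 * s + 4) ≡ 2 * (k * (2 * (o + t) + k + s + 2))
    lemma′ = ℕ-Solver.solve-∀

  nonNegative : ∀ {k d t} → t ℕ.< 3 * (k + d) + 2 → 1 ℕ.≤ k → 1 ℕ.≤ d → Large (s + β) k d →
    0ℤ ≤ alternating H k d (offset k d + t)
  nonNegative {k} {d} {t} t< 1≤k 1≤d large = ∣i-n∣≤n⇒0≤i _ (centre k (offset k d + t))
    (ℕ.≤-trans (∣alternating-centre∣≤ k d t t<) (radius≤centre t 1≤k 1≤d large))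

  -- For `d = 0` a single block is left. With `v = 2 k + 1` and `t = v + r`, the square of `t`
  -- exceeds that of `r` by at least `v²`, which absorbs `ψ r`.
  nonNegative₀ : ∀ k → β ℕ.≤ (2 * k + 1) * (2 * k + 1) → ∀ t → 0ℤ ≤ alternating H k 0 t
  nonNegative₀ k β≤ t with t ℕ.<? 2 * k + 1
  ... | yes t<2k+1 = subst (0ℤ ≤_)
      (sym (trans (cong (λ y → H t ℤ.- y) (shift-< H t<2k+1)) (ℤ.+-identityʳ (H t)))) (+≤+ z≤n)
  ... | no t≮2k+1 with ℕ.m≤n⇒∃[o]m+o≡n (ℕ.≮⇒≥ t≮2k+1)
  ...   | r , refl = subst (λ y → 0ℤ ≤ H t ℤ.- y) (sym (quadratic-≥ k r))
      (ℤ.i≤j⇒0≤j-i (+≤+ (begin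
    r * (r + s) + ψ r    ≤⟨ ℕ.+-monoʳ-≤ (r * (r + s)) (ℕ.≤-trans (ψ≤β r) β≤) ⟩
    r * (r + s) + v * v  ≤⟨ ≤-from-≡ (2 * v * r + v * s + ψ t) (lemma r v s (ψ t)) ⟩
    t * (t + s) + ψ t    ∎)))
    where
    open ℕ.≤-Reasoning
    v = 2 * k + 1
    lemma : ∀ r v s ψ → r * (r + s) + v * v + (2 * v * r + v * s + ψ) ≡ (v + r) * (v + r + s) + ψ
    lemma = ℕ-Solver.solve-∀

-- Finite verification and its combination with the estimate.

Below : ℕ → (ℕ → Set) → Set
Below D P = ∀ n → n ℕ.< D → P n

below? : ∀ D {P : ℕ → Set} → (∀ n → Dec (P n)) → Dec (Below D P)
below? D P? = map′ (λ f n → f {n}) (λ f {n} → f n) (ℕ.allUpTo? P? D)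

Large? : ∀ u k d → Dec (Large u k d)
Large? u k d = _ ℕ.≤? _

module _ (b c : ℕ) .{{_ : ℕ.NonZero b}} .{{_ : ℕ.NonZero c}} .{{_ : ℕ.NonZero (b * c)}}
         (ψs : List ℕ) (β : ℕ) where

  private
    s = 1 + b + c
    u = s + β
    ψ = periodic ψs (b * c)
    h = quadratic s ψ
    H : Series
    H x = + h x

  NonNegativeUpTo : ℕ → ℕ → Set
  NonNegativeUpTo D k = Below D λ d → Below (3 * (k + d) + 2) λ t →
    0ℤ ≤ alternating H k d (offset k d + t)

  nonNegativeUpTo? : ∀ D k → Dec (NonNegativeUpTo D k)
  nonNegativeUpTo? D k = below? D λ d → below? (3 * (k + d) + 2) λ t →
    0ℤ ℤ.≤? alternating H k d (offset k d + t)

  -- ψs lists 2bc G r - r (r + s) for r < bc, and β is its maximum.  The bound 76 on s + β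
  -- is attained for (1 , 4 , 7); Large 76 holds from (2 , 19), from (3 , 9) and from (6 , 1)
  -- on, and Large u from (1 , u + 1) on.
  record Certificate : Set where
    field
      initial : Below c λ x → h x ≡ 2 * b * c * suc (x ℕ./ b)
      residue : Below (b * c) λ r →
                ψ (c + r) + c * (c + s) + 2 * c * ((c + r) ℕ.% b) ≡ entry ψs r + 2 * c * (c + b)
      bounded : Below (b * c) λ r → entry ψs r ℕ.≤ β
      u≤76    : u ℕ.≤ 76
      k≡1     : NonNegativeUpTo (suc u) 1
      k≡2     : NonNegativeUpTo 19 2
      3≤k≤5   : Below 3 λ i → NonNegativeUpTo 9 (3 + i)

  -- All fields are bounded statements with decidable bodies, so for concrete data the type checker
  -- obtains a `Certificate` by evaluation.
  certificate? : Dec Certificate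
  certificate? = map′
    (λ (initial , residue , bounded , u≤76 , k≡1 , k≡2 , 3≤k≤5) → record
      { initial = initial ; residue = residue ; bounded = bounded ; u≤76 = u≤76
      ; k≡1 = k≡1 ; k≡2 = k≡2 ; 3≤k≤5 = 3≤k≤5 })
    (λ certificate → let open Certificate certificate in
      initial , residue , bounded , u≤76 , k≡1 , k≡2 , 3≤k≤5)
    (below? c (λ _ → _ ℕ.≟ _) ×-dec
     below? (b * c) (λ _ → _ ℕ.≟ _) ×-dec
     below? (b * c) (λ _ → _ ℕ.≤? _) ×-dec
     u ℕ.≤? 76 ×-dec
     nonNegativeUpTo? (suc u) 1 ×-dec
     nonNegativeUpTo? 19 2 ×-dec
     below? 3 λ i → nonNegativeUpTo? 9 (3 + i))

  module _ (certificate : Certificate) where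

    open Certificate certificate

    private
      ψ≤β : ∀ x → ψ x ℕ.≤ β
      ψ≤β x = bounded (x ℕ.% (b * c)) (m%n<n x (b * c))

      combine : ∀ {k} D {d t} → (∀ {d} → D ℕ.≤ d → Large u k d) →
                1 ℕ.≤ k → 1 ℕ.≤ D → NonNegativeUpTo D k →
                t ℕ.< 3 * (k + d) + 2 → 0ℤ ≤ alternating H k d (offset k d + t)
      combine {k} D {d} large 1≤k 1≤D below t< with d ℕ.<? D
      ... | yes d<D = below d d<D _ t<
      ... | no  d≮D = nonNegative s β ψ ψ≤β t< 1≤k (ℕ.≤-trans 1≤D (ℕ.≮⇒≥ d≮D)) (large (ℕ.≮⇒≥ d≮D))

      -- `Large u 1 d` amounts to `u + 1 ≤ d`, so it holds at this threshold with equality.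
      large₁ : Large u 1 (suc u)
      large₁ = ℕ.≤-reflexive (lemma u)
        where
        lemma : ∀ u → 2 * u + 6 * 1 + 4 * (1 + u) + 1 ≡ 6 * 1 * (1 + u) + 5 * (1 * 1)
        lemma = ℕ-Solver.solve-∀

    -- The smaller `k` is, the more values of `d` are computed: up to `u` for 1, up to 18 for 2, up
    -- to 8 for 3, 4 and 5. From `k = 6` on the estimate covers every `d ≥ 1`, and `nonNegative₀`
    -- covers `d = 0`.
    alternating-nonNegative : ∀ k d {t} → 1 ℕ.≤ k → t ℕ.< 3 * (k + d) + 2 →
                              0ℤ ≤ alternating H k d (offset k d + t)
    alternating-nonNegative 1 d _ t< = combine (suc u)
      (λ D≤d → Large-mono {u} ℕ.≤-refl ℕ.≤-refl ℕ.≤-refl (s≤s z≤n) D≤d large₁)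
      ℕ.≤-refl (s≤s z≤n) k≡1 t<
    alternating-nonNegative 2 d _ t< = combine 19
      (λ 19≤d → Large-mono {k = 2} u≤76 (s≤s z≤n) ℕ.≤-refl (s≤s z≤n) 19≤d (from-yes (Large? 76 2 19)))
      (s≤s z≤n) (s≤s z≤n) k≡2 t<
    alternating-nonNegative (suc (suc (suc i))) d _ t< with i ℕ.<? 3
    ... | yes i<3 = combine 9
      (λ 9≤d → Large-mono u≤76 (s≤s z≤n) (ℕ.m≤m+n 3 i) (s≤s z≤n) 9≤d (from-yes (Large? 76 3 9)))
      (s≤s z≤n) (s≤s z≤n) (3≤k≤5 i i<3) t<
    alternating-nonNegative (suc (suc (suc i))) zero {t} _ t< | no i≮3 =
      nonNegative₀ s β ψ ψ≤β (3 + i) β≤ t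
      where
      -- Here `i ≥ 3`, so the square of `2 k + 1` is at least 169, beyond `β ≤ u ≤ 76`.
      13≤ : 13 ℕ.≤ 2 * (3 + i) + 1
      13≤ = ℕ.+-monoˡ-≤ 1 (ℕ.*-monoʳ-≤ 2 (ℕ.+-monoʳ-≤ 3 (ℕ.≮⇒≥ i≮3)))
      β≤ : β ℕ.≤ (2 * (3 + i) + 1) * (2 * (3 + i) + 1)
      β≤ = ℕ.≤-trans (ℕ.≤-trans (ℕ.m≤n+m β s) (ℕ.≤-trans u≤76 (from-yes (76 ℕ.≤? 13 * 13))))
        (ℕ.*-mono-≤ 13≤ 13≤)
    alternating-nonNegative (suc (suc (suc i))) (suc d) _ t< | no i≮3 =
      nonNegative s β ψ ψ≤β {3 + i} {suc d} t< (s≤s z≤n) (s≤s z≤n)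
      (Large-mono u≤76 (s≤s z≤n) (ℕ.+-monoʳ-≤ 3 (ℕ.≮⇒≥ i≮3)) (s≤s z≤n) (s≤s z≤n) (from-yes (Large? 76 6 1)))

    γ-nonNegative : ∀ k n → 1 ℕ.≤ k → 0ℤ ≤ γ 1 b c (+ 3 / 2) (+ 1 / 2) k n
    γ-nonNegative k n 1≤k = subst (0ℤ ≤_) (sym (γ-alternating 1 b c k n)) shifted
      where
      N = bound (+ 3 / 2) (+ 1 / 2) n
      G = 1/1-q^ 1 ⊛ 1/1-q^ b ⊛ 1/1-q^ c
      K = 2 * b * c
      instance
        K≢0 : ℕ.NonZero K
        K≢0 = ℕ.m*n≢0 (2 * b) c {{ℕ.m*n≢0 2 b}}
      scaled : ∀ x → + K ℤ.* alternating G k N x ≡ alternating H k N x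
      scaled x = trans (sym (alternating-* (+ K) G k N x))
        (alternating-cong (quasipolynomial b c ψs (initial _) (residue _)) k N x)
      unshifted : ∀ x → x ℕ.≤ N → 0ℤ ≤ alternating G k N x
      -- Since `d ≤ x ≤ N`, truncation at `N` may be replaced by truncation at `d`; the positive
      -- factor `2 b c` is then cancelled.
      unshifted x x≤N with offset-view k x
      ... | d , t , t< , refl , d≤x = ℤ.*-cancelˡ-≤-pos 0ℤ _ (+ K) {{ℤ.positive (ℤ.+<+ (ℕ.>-nonZero⁻¹ K))}}
        (subst₂ _≤_ (sym (ℤ.*-zeroʳ (+ K)))
          (sym (trans (scaled x) (alternating-stable H k d N t< (ℕ.≤-trans d≤x x≤N))))
          (alternating-nonNegative k d 1≤k t<))
      shifted : 0ℤ ≤ shift (pentagonal k) (alternating G k N) n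
      shifted with n ℕ.<? pentagonal k
      ... | yes n<g = ℤ.≤-reflexive (sym (shift-< (alternating G k N) n<g))
      ... | no  n≮g with ℕ.m≤n⇒∃[o]m+o≡n (ℕ.≮⇒≥ n≮g)
      ...   | x , refl = subst (0ℤ ≤_) (sym (shift-≥ (pentagonal k) (alternating G k N) x))
        -- Here `N` evaluates to `2 (n + 1)`.
        (unshifted x (begin
        x                ≤⟨ ℕ.m≤n+m x (pentagonal k) ⟩
        n                ≤⟨ ℕ.m≤m+n n 1 ⟩
        n + 1            ≤⟨ ℕ.m≤m+n (n + 1) _ ⟩
        2 * (n + 1)      ∎))
        where open ℕ.≤-Reasoning

-- The eight triples.

γ-nonNegative-1-2-3 : ∀ k n → 1 ℕ.≤ k → 0ℤ ≤ γ 1 2 3 (+ 3 / 2) (+ 1 / 2) k n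
γ-nonNegative-1-2-3 = γ-nonNegative 2 3 ψs 12 (from-yes (certificate? 2 3 ψs 12))
  where
  ψs : List ℕ
  ψs = 12 ∷ 5 ∷ 8 ∷ 9 ∷ 8 ∷ 5 ∷ []

γ-nonNegative-1-2-5 : ∀ k n → 1 ℕ.≤ k → 0ℤ ≤ γ 1 2 5 (+ 3 / 2) (+ 1 / 2) k n
γ-nonNegative-1-2-5 = γ-nonNegative 2 5 ψs 20 (from-yes (certificate? 2 5 ψs 20))
  where
  ψs : List ℕ
  ψs = 20 ∷ 11 ∷ 20 ∷ 7 ∷ 12 ∷ 15 ∷ 16 ∷ 15 ∷ 12 ∷ 7 ∷ []

γ-nonNegative-1-2-7 : ∀ k n → 1 ℕ.≤ k → 0ℤ ≤ γ 1 2 7 (+ 3 / 2) (+ 1 / 2) k n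
γ-nonNegative-1-2-7 = γ-nonNegative 2 7 ψs 32 (from-yes (certificate? 2 7 ψs 32))
  where
  ψs : List ℕ
  ψs = 28 ∷ 17 ∷ 32 ∷ 17 ∷ 28 ∷ 9 ∷ 16 ∷ 21 ∷ 24 ∷ 25 ∷ 24 ∷ 21 ∷ 16 ∷ 9 ∷ []

γ-nonNegative-1-3-4 : ∀ k n → 1 ℕ.≤ k → 0ℤ ≤ γ 1 3 4 (+ 3 / 2) (+ 1 / 2) k n
γ-nonNegative-1-3-4 = γ-nonNegative 3 4 ψs 24 (from-yes (certificate? 3 4 ψs 24))
  where
  ψs : List ℕ
  ψs = 24 ∷ 15 ∷ 4 ∷ 15 ∷ 24 ∷ 7 ∷ 12 ∷ 15 ∷ 16 ∷ 15 ∷ 12 ∷ 7 ∷ []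

γ-nonNegative-1-3-5 : ∀ k n → 1 ℕ.≤ k → 0ℤ ≤ γ 1 3 5 (+ 3 / 2) (+ 1 / 2) k n
γ-nonNegative-1-3-5 = γ-nonNegative 3 5 ψs 30 (from-yes (certificate? 3 5 ψs 30))
  where
  ψs : List ℕ
  ψs = 30 ∷ 20 ∷ 8 ∷ 24 ∷ 8 ∷ 20 ∷ 30 ∷ 8 ∷ 14 ∷ 18 ∷ 20 ∷ 20 ∷ 18 ∷ 14 ∷ 8 ∷ []

γ-nonNegative-1-3-8 : ∀ k n → 1 ℕ.≤ k → 0ℤ ≤ γ 1 3 8 (+ 3 / 2) (+ 1 / 2) k n
γ-nonNegative-1-3-8 = γ-nonNegative 3 8 ψs 51 (from-yes (certificate? 3 8 ψs 51))
  where
  ψs : List ℕ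
  ψs = 48 ∷ 35 ∷ 20 ∷ 51 ∷ 32 ∷ 11 ∷ 36 ∷ 11 ∷ 32 ∷ 51 ∷ 20 ∷ 35 ∷ 48 ∷ 11 ∷ 20 ∷ 27 ∷ 32 ∷ 35 ∷ 36 ∷ 35 ∷
         32 ∷ 27 ∷ 20 ∷ 11 ∷ []

γ-nonNegative-1-4-5 : ∀ k n → 1 ℕ.≤ k → 0ℤ ≤ γ 1 4 5 (+ 3 / 2) (+ 1 / 2) k n
γ-nonNegative-1-4-5 = γ-nonNegative 4 5 ψs 45 (from-yes (certificate? 4 5 ψs 45))
  where
  ψs : List ℕ
  ψs = 40 ∷ 29 ∷ 16 ∷ 1 ∷ 24 ∷ 45 ∷ 24 ∷ 1 ∷ 16 ∷ 29 ∷ 40 ∷ 9 ∷ 16 ∷ 21 ∷ 24 ∷ 25 ∷ 24 ∷ 21 ∷ 16 ∷ 9 ∷ []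

γ-nonNegative-1-4-7 : ∀ k n → 1 ℕ.≤ k → 0ℤ ≤ γ 1 4 7 (+ 3 / 2) (+ 1 / 2) k n
γ-nonNegative-1-4-7 = γ-nonNegative 4 7 ψs 64 (from-yes (certificate? 4 7 ψs 64))
  where
  ψs : List ℕ
  ψs = 56 ∷ 43 ∷ 28 ∷ 11 ∷ 48 ∷ 27 ∷ 4 ∷ 35 ∷ 64 ∷ 35 ∷ 4 ∷ 27 ∷ 48 ∷ 11 ∷ 28 ∷ 43 ∷ 56 ∷ 11 ∷ 20 ∷ 27 ∷
         32 ∷ 35 ∷ 36 ∷ 35 ∷ 32 ∷ 27 ∷ 20 ∷ 11 ∷ []

corollary2p3 : (k n a b c : ℕ) → 1 ℕ.≤ k →
    (a , b , c) ∈ ( (1 , 2 , 3) ∷ (1 , 2 , 5) ∷ (1 , 2 , 7) ∷ (1 , 3 , 4)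
    ∷ (1 , 3 , 5) ∷ (1 , 3 , 8) ∷ (1 , 4 , 5) ∷ (1 , 4 , 7) ∷ [] ) →
    0ℤ ≤ γ a b c (+ 3 / 2) (+ 1 / 2) k n
corollary2p3 k n a b c 1≤k (here refl) = γ-nonNegative-1-2-3 k n 1≤k
corollary2p3 k n a b c 1≤k (there (here refl)) = γ-nonNegative-1-2-5 k n 1≤k
corollary2p3 k n a b c 1≤k (there (there (here refl))) = γ-nonNegative-1-2-7 k n 1≤k
corollary2p3 k n a b c 1≤k (there (there (there (here refl)))) = γ-nonNegative-1-3-4 k n 1≤k
corollary2p3 k n a b c 1≤k (there (there (there (there (here refl))))) = γ-nonNegative-1-3-5 k n 1≤k
corollary2p3 k n a b c 1≤k (there (there (there (there (there (here refl)))))) = γ-nonNegative-1-3-8 k n 1≤k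
corollary2p3 k n a b c 1≤k (there (there (there (there (there (there (here refl))))))) = γ-nonNegative-1-4-5 k n 1≤k
corollary2p3 k n a b c 1≤k (there (there (there (there (there (there (there (here refl)))))))) = γ-nonNegative-1-4-7 k n 1≤k
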